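{- For every integer $g\ge 2$, the signed graph $(\mathrm{TT}(g),J)$, which has $\lfloor g^2/2\rfloor$ vertices, is $\mathcal{SP}$-complete.
   Context: Let $a=\lfloor g/2\rfloor$ and $b=\lceil g/2\rceil$. The graph $\mathrm{T}(g)$ has vertex set $\{0,\dots,2a-1\}\times\{0,\dots,b-1\}$, with vertical edges $\{(i,j),(i,j+1)\}$ and horizontal edges $\{(i,j),(i',j)\}$ whenever $i-i'\equiv \pm1 \pmod{2a}$ (so it is the cylinder $C_{2a}\square P_b$). $\mathrm{TT}(g)$ is obtained from $\mathrm{T}(g)$ by adding, for each antipodal pair, an edge $\{(i,0),(i+a \bmod 2a,\,b-1)\}$ (these are the pairs of vertices at distance $a+b-1$ in $\mathrm{T}(g)$); the set of these added edges is $J$ (if such a pair is already a horizontal edge, as happens for $g=2$, the added edge is a parallel edge). The signed graph $(\mathrm{TT}(g),J)$ has exactly the edges of $J$ negative and all other edges positive. A signed graph $(G,\sigma)$ is a graph (loops and parallel edges allowed) with $\sigma:E(G)\to\{+,-\}$. The sign of a closed walk is the product of the signs of its edges with multiplicity. Switching at a vertex set $X$ multiplies by $-$ the signs of all edges in the cut $(X,V\setminus X)$. A closed walk has type $ij\in\mathbb{Z}_2^2$ with $i=0$ if positive, $i=1$ if negative, and $j$ the parity of its length; $g_{ij}(G,\sigma)$ is the minimum length of a closed walk of type $ij$ ($\infty$ if none). A homomorphism of $(G,\sigma)$ to $(H,\pi)$ consists of a signature $\sigma'$ switching equivalent to $\sigma$ and a mapping of vertices to vertices and edges to edges preserving adjacencies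 and incidences, with every edge $e$ mapped to an edge of sign $\sigma'(e)$. $\mathcal{SP}$ is the class of signed graphs $(G,\sigma)$ with $G$ a simple connected $K_4$-minor-free graph; $(B,\pi)$ is $\mathcal{SP}$-complete if every $(G,\sigma)\in\mathcal{SP}$ with $g_{ij}(G,\sigma)\ge g_{ij}(B,\pi)$ for all $ij\in\mathbb{Z}_2^2$ admits a homomorphism to $(B,\pi)$. -}

module Defs where

open import Data.Nat using (ℕ; zero; suc; _+_; _*_; _∸_; _/_; _≤_; _≡ᵇ_; _<ᵇ_)
open import Data.Fin using (Fin; toℕ)
open import Data.Bool using (Bool; true; false; _∧_; _∨_; _xor_; T; not)
open import Data.Maybe using (Maybe; just)
open import Data.Product using (Σ; ∃; _×_; _,_; proj₁; proj₂)
open import Data.Sum using (_⊎_; inj₁; inj₂)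
open import Relation.Binary.PropositionalEquality using (_≡_; _≢_)
open import Relation.Nullary using (¬_)

-- Signed (multi)graphs: loops and parallel edges allowed.
-- sign e = true  means e is negative, false means positive.

record SignedGraph : Set₁ where
  field
    V    : Set
    E    : Set
    ends : E → V × V
    sign : E → Bool
open SignedGraph public

finSG : (n m : ℕ) → (Fin m → Fin n × Fin n) → (Fin m → Bool) → SignedGraph
finSG n m en σ = record { V = Fin n ; E = Fin m ; ends = en ; sign = σ }

data Step (G : SignedGraph) (u w : V G) : Set where
  fwd : (e : E G) → ends G e ≡ (u , w) → Step G u w
  bwd : (e : E G) → ends G e ≡ (w , u) → Step G u w

stepEdge : ∀ {G u w} → Step G u w → E G
stepEdge (fwd e _) = e
stepEdge (bwd e _) = e

data Walk (G : SignedGraph) : V G → V G → Set where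
  []  : ∀ {u} → Walk G u u
  _∷_ : ∀ {u w v} → Step G u w → Walk G w v → Walk G u v

walkLength : ∀ {G u v} → Walk G u v → ℕ
walkLength []       = 0
walkLength (s ∷ w) = suc (walkLength w)

walkSign : ∀ {G u v} → Walk G u v → Bool
walkSign []              = false
walkSign {G} (s ∷ w) = sign G (stepEdge s) xor walkSign w

odd : ℕ → Bool
odd zero    = false
odd (suc n) = not (odd n)

walkType : ∀ {G v} → Walk G v v → Bool × Bool
walkType w = walkSign w , odd (walkLength w)

-- g_ij(G) ≥ g_ij(B), with the convention min ∅ = ∞, written out:
-- every closed walk of type ij in G has length at least that of some
-- closed walk of type ij in B.
GirthGE : SignedGraph → SignedGraph → Bool × Bool → Set
GirthGE G B ij =
  ∀ (v : V G) (W : Walk G v v) → walkType W ≡ ij →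
  Σ (V B) λ u → Σ (Walk B u u) λ W′ → (walkType W′ ≡ ij) × (walkLength W′ ≤ walkLength W)

-- Homomorphisms of signed graphs.
-- A switching set X : V G → Bool gives σ′(e) = σ(e) xor [e ∈ cut(X)].

Hom : SignedGraph → SignedGraph → Set
Hom G H =
  Σ (V G → Bool) λ X →
  Σ (V G → V H) λ φ →
  Σ (E G → E H) λ ψ →
    (∀ e → ends H (ψ e) ≡ (φ (proj₁ (ends G e)) , φ (proj₂ (ends G e)))
         ⊎ ends H (ψ e) ≡ (φ (proj₂ (ends G e)) , φ (proj₁ (ends G e))))
  × (∀ e → sign H (ψ e) ≡ (sign G e xor (X (proj₁ (ends G e)) xor X (proj₂ (ends G e)))))

Simple : SignedGraph → Set
Simple G =
  (∀ e → proj₁ (ends G e) ≢ proj₂ (ends G e)) ×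
  (∀ e e′ → (ends G e ≡ ends G e′
            ⊎ (proj₁ (ends G e) ≡ proj₂ (ends G e′) × proj₂ (ends G e) ≡ proj₁ (ends G e′)))
          → e ≡ e′)

Connected : SignedGraph → Set
Connected G = ∀ (u v : V G) → Walk G u v

data WalkIn (G : SignedGraph) (P : V G → Set) : V G → V G → Set where
  here : ∀ {u} → P u → WalkIn G P u u
  step : ∀ {u w v} → P u → Step G u w → WalkIn G P w v → WalkIn G P u v

-- K4 is a minor of G: there are four pairwise disjoint, nonempty,
-- connected branch sets (β v = just i means v lies in branch set i),
-- every two of which are joined by an edge.
HasK4Minor : SignedGraph → Set
HasK4Minor G =
  Σ (V G → Maybe (Fin 4)) λ β →
    (∀ i → Σ (V G) λ v → β v ≡ just i)
  × (∀ i u v → β u ≡ just i → β v ≡ just i → WalkIn G (λ w → β w ≡ just i) u v)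
  × (∀ i j → i ≢ j → Σ (E G) λ e →
       (β (proj₁ (ends G e)) ≡ just i × β (proj₂ (ends G e)) ≡ just j)
     ⊎ (β (proj₁ (ends G e)) ≡ just j × β (proj₂ (ends G e)) ≡ just i))

K4MinorFree : SignedGraph → Set
K4MinorFree G = ¬ HasK4Minor G

SPComplete : SignedGraph → Set
SPComplete B =
  ∀ (n m : ℕ) (en : Fin m → Fin n × Fin n) (σ : Fin m → Bool) →
  Simple (finSG n m en σ) → Connected (finSG n m en σ) → K4MinorFree (finSG n m en σ) →
  (∀ ij → GirthGE (finSG n m en σ) B ij) →
  Hom (finSG n m en σ) B

aOf bOf : ℕ → ℕ
aOf g = g / 2
bOf g = g ∸ g / 2

VT : ℕ → Set
VT g = Fin (2 * aOf g) × Fin (bOf g)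

succMod : ℕ → ℕ → ℕ → Bool
succMod n i i′ = (i′ ≡ᵇ suc i) ∨ ((suc i ≡ᵇ n) ∧ (i′ ≡ᵇ 0))

-- adjacency in T(g) = C_{2a} □ P_b
adjT : (g : ℕ) → VT g → VT g → Bool
adjT g (i , j) (i′ , j′) =
    ((toℕ j ≡ᵇ toℕ j′) ∧ (succMod (2 * aOf g) (toℕ i) (toℕ i′) ∨ succMod (2 * aOf g) (toℕ i′) (toℕ i)))
  ∨ ((toℕ i ≡ᵇ toℕ i′) ∧ ((toℕ j′ ≡ᵇ suc (toℕ j)) ∨ (toℕ j ≡ᵇ suc (toℕ j′))))

-- {(i,0), (i + a mod 2a, b-1)}: for i, i′ < 2a, i′ ≡ i + a (mod 2a) iff |i - i′| = a
antip : (g : ℕ) → ℕ → ℕ → Bool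
antip g i i′ = (i′ + aOf g ≡ᵇ i) ∨ (i + aOf g ≡ᵇ i′)

adjJ : (g : ℕ) → VT g → VT g → Bool
adjJ g (i , j) (i′ , j′) =
    ((toℕ j ≡ᵇ 0) ∧ (toℕ j′ ≡ᵇ bOf g ∸ 1) ∧ antip g (toℕ i) (toℕ i′))
  ∨ ((toℕ j′ ≡ᵇ 0) ∧ (toℕ j ≡ᵇ bOf g ∸ 1) ∧ antip g (toℕ i) (toℕ i′))

-- a linear order code on vertices, used to list each unordered pair once
code : (g : ℕ) → VT g → ℕ
code g (i , j) = toℕ j * (2 * aOf g) + toℕ i

-- edges of T(g) (one per adjacent unordered pair) and edges of J
-- (one per antipodal unordered pair); J-edges are separate, so they are
-- parallel to a T-edge when the pair is already adjacent.
ET : (g : ℕ) → Set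
ET g = Σ (VT g × VT g) λ p → T ((code g (proj₁ p) <ᵇ code g (proj₂ p)) ∧ adjT g (proj₁ p) (proj₂ p))

EJ : (g : ℕ) → Set
EJ g = Σ (VT g × VT g) λ p → T ((code g (proj₁ p) <ᵇ code g (proj₂ p)) ∧ adjJ g (proj₁ p) (proj₂ p))

endsTT : (g : ℕ) → ET g ⊎ EJ g → VT g × VT g
endsTT g (inj₁ e) = proj₁ e
endsTT g (inj₂ e) = proj₁ e

signTT : (g : ℕ) → ET g ⊎ EJ g → Bool
signTT g (inj₁ _) = false
signTT g (inj₂ _) = true

TTJ : ℕ → SignedGraph
TTJ g = record { V = VT g ; E = ET g ⊎ EJ g ; ends = endsTT g ; sign = signTT g }

{-# OPTIONS --safe #-}
-- The signed double cover of (TT(g), J) is the torus C_2a □ C_2b with the antipodal map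
-- (x , y) ↦ (x + a , y + b), and dist(P, Q) + dist(P, −Q) = a + b = g.  A homomorphism from (G, σ)
-- is therefore a map f to the torus with f u at distance 1 from ± f v for every edge uv of sign ±.
--
-- The signed distances of G can be shortened, pair by pair, until the positive and the negative
-- distance of any two vertices add up to g; edges still have length 1, and every triple of
-- vertices then satisfies the conditions under which the torus has a third point at
-- two prescribed distances from two given points.  Since min-degree-3 graphs have a K4 minor,
-- G is reduced to a point by contracting vertices of degree at most 2 into a neighbour, and f is
-- built by undoing these contractions.
module Submission where

open import Defs
open import Data.Bool using (Bool; true; false; _∧_; _xor_; not; T; if_then_else_) renaming (_≟_ to _≟ᵇ_)
open import Data.Bool.Properties using (xor-assoc; xor-comm; xor-same; xor-identityʳ; not-distribʳ-xor; not-distribˡ-xor; not-involutive; ¬-not; T-∧; T-∨)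
open import Data.Bool.Solver using (module xor-∧-Solver)
open import Data.Fin using (Fin; zero; suc; toℕ; fromℕ<; combine; remQuot)
open import Data.Fin.Properties using (_≟_; any?; toℕ<n; toℕ-fromℕ<; toℕ-injective; toℕ-combine; combine-injective; combine-remQuot; *↔×)
open import Data.Fin.Subset using (Subset; _∈_) renaming (∣_∣ to card; _-_ to _∖_; ⊤ to everything)
open import Data.Fin.Subset.Properties using (∈⊤; x∈p∧x≢y⇒x∈p-y; x∈p⇒∣p-x∣<∣p∣)
open import Data.Maybe using (Maybe; just; nothing)
open import Data.Nat hiding (parity; _≟_)
open import Data.Nat.DivMod using (m/n≤m; m/n*n≤m; m≡m%n+[m/n]*n; m%n<n; m*n/n≡m; +-distrib-/-∣ʳ; m≥n⇒m/n>0)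
open import Data.Nat.Divisibility using (divides)
open import Data.Nat.Properties hiding (_≟_)
open import Data.Nat.Tactic.RingSolver using (solve-∀)
open import Data.Product using (Σ; ∃; _×_; _,_; proj₁; proj₂) renaming (swap to swap-×)
open import Data.Sum using (_⊎_; inj₁; inj₂; [_,_]′) renaming (swap to swap-⊎)
open import Data.Unit using (⊤)
open import Data.Vec.Functional using (updateAt)
open import Data.Vec.Functional.Properties using (updateAt-updates; updateAt-minimal)
open import Function using (_∘_; id; const; Equivalence)
open import Function.Bundles using (_↔_)
open import Function.Properties.Inverse using (↔-sym)
open import Relation.Binary.Definitions using (tri<; tri≈; tri>)
open import Relation.Binary.PropositionalEquality
open import Relation.Nullary using (¬_; Dec; yes; no; contradiction)
open import Relation.Nullary.Decidable using (map′; _×-dec_; _⊎-dec_; ¬?)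

open Equivalence using (to; from)

-- The torus

-- Contractions create adjacencies that G does not have, which is why distances are prescribed for
-- all pairs of vertices and not just for edges. The conditions on a triple are the triangle
-- inequalities, a perimeter of at most 2g (again a triangle inequality, with two negative
-- distances) and an even perimeter. They give four natural numbers α, β, γ, δ with sum g, and a
-- third point is found by distributing these over the two cycles. A cycle has the required point as
-- soon as one of its four parts is 0; this can be arranged because the half-lengths ⌊g/2⌋ and ⌈g/2⌉
-- differ by at most 1. Even perimeters come from a vertex colouring forced by the parities of
-- closed walks. Distances are cut off at g with their parity kept, so that the initial values
-- without a walk behind them are g or g - 1.

odd-+ : ∀ m n → odd (m + n) ≡ odd m xor odd n
odd-+ zero    n = refl
odd-+ (suc m) n = trans (cong not (odd-+ m n)) (not-distribˡ-xor (odd m) (odd n))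

odd-∣-∣ : ∀ m n → odd ∣ m - n ∣ ≡ odd m xor odd n
odd-∣-∣ zero    n       = refl
odd-∣-∣ (suc m) zero    = sym (xor-comm (odd (suc m)) false)
odd-∣-∣ (suc m) (suc n) = trans (odd-∣-∣ m n) (lemma (odd m) (odd n))
  where
  lemma : ∀ p q → p xor q ≡ not p xor not q
  lemma false q = sym (not-involutive q)
  lemma true  q = refl

odd-∸ : ∀ {m n} → n ≤ m → odd (m ∸ n) ≡ odd m xor odd n
odd-∸ {m} {n} n≤m = trans (cong odd (sym (trans (∣-∣-comm m n) (m≤n⇒∣m-n∣≡n∸m n≤m)))) (odd-∣-∣ m n)

xor-interchange : ∀ p q r s → (p xor q) xor (r xor s) ≡ (p xor r) xor (q xor s)
xor-interchange = solve 4 (λ p q r s → (p :+ q) :+ (r :+ s) := (p :+ r) :+ (q :+ s)) refl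
  where open xor-∧-Solver

xor-telescope : ∀ p q r → (p xor q) xor (q xor r) ≡ p xor r
xor-telescope = solve 3 (λ p q r → (p :+ q) :+ (q :+ r) := p :+ r) refl
  where open xor-∧-Solver

pair-perimeter : ∀ {m} j k → j ≤ m → k ≤ m → j + k + ∣ j - k ∣ ≤ m + m
pair-perimeter zero k _ k≤m = +-mono-≤ k≤m k≤m
pair-perimeter (suc j) zero j≤m _ rewrite +-identityʳ j = +-mono-≤ j≤m j≤m
pair-perimeter {suc m} (suc j) (suc k) (s≤s j≤m) (s≤s k≤m)
  rewrite +-suc j k | +-suc m m = s≤s (s≤s (pair-perimeter j k j≤m k≤m))

-- On a line the three gaps add up to twice the largest one. The points are shifted down together
-- until one of them is 0.
perimeter : ∀ {m} i j k → i ≤ m → j ≤ m → k ≤ m → ∣ i - k ∣ + (∣ i - j ∣ + ∣ j - k ∣) ≤ m + m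
perimeter {m} zero j k _ j≤m k≤m = subst (_≤ m + m) (lemma j k ∣ j - k ∣) (pair-perimeter j k j≤m k≤m)
  where
  lemma : ∀ j k d → j + k + d ≡ k + (j + d)
  lemma = solve-∀
perimeter {m} (suc i) zero k i≤m _ k≤m =
  subst (_≤ m + m) (lemma (suc i) k ∣ suc i - k ∣) (pair-perimeter (suc i) k i≤m k≤m)
  where
  lemma : ∀ j k d → j + k + d ≡ d + (j + k)
  lemma = solve-∀
perimeter {m} (suc i) (suc j) zero i≤m j≤m _ =
  subst (_≤ m + m) (lemma (suc i) (suc j) ∣ i - j ∣) (pair-perimeter (suc i) (suc j) i≤m j≤m)
  where
  lemma : ∀ j k d → j + k + d ≡ j + (d + k)
  lemma = solve-∀
perimeter {suc m} (suc i) (suc j) (suc k) (s≤s i≤m) (s≤s j≤m) (s≤s k≤m) =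
  ≤-trans (perimeter i j k i≤m j≤m k≤m) (+-mono-≤ (n≤1+n m) (n≤1+n m))

-- The 2m-cycle; (i , false) and (i , true) are antipodal.
Cyc : ℕ → Set
Cyc m = Fin m × Bool

flip : ∀ {m} → Cyc m → Cyc m
flip (i , s) = i , not s

-- Between points on different halves with gap k the two ways round the 2m-cycle have lengths m - k
-- and m + k, so the shorter is m - k.
arc : ℕ → ℕ → Bool → ℕ
arc m k false = k
arc m k true  = m ∸ k

dC : ∀ {m} → Cyc m → Cyc m → ℕ
dC {m} (i , s) (j , t) = arc m ∣ toℕ i - toℕ j ∣ (s xor t)

gap≤ : ∀ {m} (i j : Fin m) → ∣ toℕ i - toℕ j ∣ ≤ m
gap≤ i j = ≤-trans (∣m-n∣≤m⊔n (toℕ i) (toℕ j)) (⊔-lub (<⇒≤ (toℕ<n i)) (<⇒≤ (toℕ<n j)))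

dC-sym : ∀ {m} (X Y : Cyc m) → dC X Y ≡ dC Y X
dC-sym {m} (i , s) (j , t) = cong₂ (arc m) (∣-∣-comm (toℕ i) (toℕ j)) (xor-comm s t)

arc-not : ∀ {m k} → k ≤ m → ∀ s → arc m k s + arc m k (not s) ≡ m
arc-not k≤m false = m+[n∸m]≡n k≤m
arc-not k≤m true  = m∸n+n≡m k≤m

dC-flip : ∀ {m} (X Y : Cyc m) → dC X Y + dC X (flip Y) ≡ m
dC-flip {m} (i , s) (j , t) rewrite sym (not-distribʳ-xor s t) = arc-not (gap≤ i j) (s xor t)

dC-flip-flip : ∀ {m} (X Y : Cyc m) → dC (flip X) (flip Y) ≡ dC X Y
dC-flip-flip {m} (i , s) (j , t) = cong (arc m ∣ toℕ i - toℕ j ∣) (xor-interchange true s true t)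

dC-refl : ∀ {m} (X : Cyc m) → dC X X ≡ 0
dC-refl (i , s) rewrite xor-same s = ∣n-n∣≡0 (toℕ i)

-- Complementing two of the three sides permutes the four hypotheses, the three triangle
-- inequalities and the perimeter bound; each sign pattern is therefore one of them rewritten.
arc-triangle : ∀ {m A B C} → B ≤ m → C ≤ m → A ≤ B + C → B ≤ A + C → C ≤ A + B →
  A + (B + C) ≤ m + m → ∀ s t → arc m A (s xor t) ≤ arc m B s + arc m C t
arc-triangle _ _ A≤ _ _ _ false false = A≤
arc-triangle {m} {A} {B} {C} _ C≤m _ _ C≤ _ false true = m≤n+o⇒m∸n≤o m A (begin
  m                   ≡⟨ sym (m+[n∸m]≡n C≤m) ⟩
  C + (m ∸ C)         ≤⟨ +-monoˡ-≤ (m ∸ C) C≤ ⟩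
  A + B + (m ∸ C)     ≡⟨ +-assoc A B (m ∸ C) ⟩
  A + (B + (m ∸ C))   ∎)
  where open ≤-Reasoning
arc-triangle {m} {A} {B} {C} B≤m _ _ B≤ _ _ true false = m≤n+o⇒m∸n≤o m A (begin
  m                   ≡⟨ sym (m+[n∸m]≡n B≤m) ⟩
  B + (m ∸ B)         ≤⟨ +-monoˡ-≤ (m ∸ B) B≤ ⟩
  A + C + (m ∸ B)     ≡⟨ lemma A C (m ∸ B) ⟩
  A + (m ∸ B + C)     ∎)
  where
  open ≤-Reasoning
  lemma : ∀ x y z → x + y + z ≡ x + (z + y)
  lemma = solve-∀
arc-triangle {m} {A} {B} {C} B≤m C≤m _ _ _ per true true = +-cancelʳ-≤ (B + C) A (m ∸ B + (m ∸ C)) (begin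
  A + (B + C)                   ≤⟨ per ⟩
  m + m                         ≡⟨ sym (cong₂ _+_ (m∸n+n≡m B≤m) (m∸n+n≡m C≤m)) ⟩
  (m ∸ B + B) + (m ∸ C + C)     ≡⟨ lemma (m ∸ B) B (m ∸ C) C ⟩
  m ∸ B + (m ∸ C) + (B + C)     ∎)
  where
  open ≤-Reasoning
  lemma : ∀ x y z w → (x + y) + (z + w) ≡ x + z + (y + w)
  lemma = solve-∀

dC-triangle : ∀ {m} (X Y Z : Cyc m) → dC X Z ≤ dC X Y + dC Y Z
dC-triangle {m} (i , s) (j , t) (k , u) =
  subst (λ r → arc m ∣ toℕ i - toℕ k ∣ r ≤ dC (i , s) (j , t) + dC (j , t) (k , u)) (xor-telescope s t u)
    (arc-triangle (gap≤ i j) (gap≤ j k)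
      (∣-∣-triangle (toℕ i) (toℕ j) (toℕ k))
      (subst (λ x → ∣ toℕ i - toℕ j ∣ ≤ ∣ toℕ i - toℕ k ∣ + x) (∣-∣-comm (toℕ k) (toℕ j)) (∣-∣-triangle (toℕ i) (toℕ k) (toℕ j)))
      (≤-trans (∣-∣-triangle (toℕ j) (toℕ i) (toℕ k))
        (≤-reflexive (trans (+-comm ∣ toℕ j - toℕ i ∣ _) (cong (∣ toℕ i - toℕ k ∣ +_) (∣-∣-comm (toℕ j) (toℕ i))))))
      (perimeter (toℕ i) (toℕ j) (toℕ k) (<⇒≤ (toℕ<n i)) (<⇒≤ (toℕ<n j)) (<⇒≤ (toℕ<n k)))
      (s xor t) (t xor u))

odd-arc : ∀ {m k} → k ≤ m → ∀ s → odd (arc m k s) ≡ odd k xor (s ∧ odd m)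
odd-arc {m} {k} _ false = xor-comm false (odd k)
odd-arc {m} {k} k≤m true = trans (odd-∸ k≤m) (xor-comm (odd m) (odd k))

Between : ∀ {m} → Cyc m → Cyc m → ℕ → ℕ → Set
Between X Y α β = ∃ λ Z → dC X Z ≡ α × dC Y Z ≡ β

∣m+n-m∣≡n : ∀ m n → ∣ m + n - m ∣ ≡ n
∣m+n-m∣≡n m n = trans (∣-∣-comm (m + n) m) (∣m-m+n∣≡n m n)

toℕ-dC : ∀ {m} (i : Fin m) s {k} (k<m : k < m) t → dC (i , s) (fromℕ< k<m , t) ≡ arc m ∣ toℕ i - k ∣ (s xor t)
toℕ-dC {m} i s k<m t = cong (λ x → arc m ∣ toℕ i - x ∣ (s xor t)) (toℕ-fromℕ< k<m)

between-same : ∀ {m} (i j : Fin m) s {α β} → toℕ j ≡ toℕ i + (α + β) → Between (i , s) (j , s) α β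
between-same {m} i j s {α} {β} j≡ = (fromℕ< k<m , s) ,
  trans (toℕ-dC i s k<m s) (subst (λ r → arc m ∣ toℕ i - k ∣ r ≡ α) (sym (xor-same s)) (∣m-m+n∣≡n (toℕ i) α)) ,
  trans (toℕ-dC j s k<m s) (subst (λ r → arc m ∣ toℕ j - k ∣ r ≡ β) (sym (xor-same s))
    (trans (cong ∣_- k ∣ j≡′) (∣m+n-m∣≡n k β)))
  where
  k = toℕ i + α
  j≡′ : toℕ j ≡ k + β
  j≡′ = trans j≡ (sym (+-assoc (toℕ i) α β))
  k<m : k < m
  k<m = ≤-<-trans (m≤m+n k β) (subst (_< m) j≡′ (toℕ<n j))

xor-not-self : ∀ s → s xor not s ≡ true
xor-not-self false = refl
xor-not-self true = refl

-- The geodesic runs from i down to 0, and then on the other half from m ∸ 1 down to j.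
between-opposite : ∀ {m} (i j : Fin m) s {α β e} → toℕ j ≡ toℕ i + e → α + β + e ≡ m →
  Between (i , s) (j , not s) α β
between-opposite {m} i j s {α} {β} {e} j≡ m≡ with α ≤? toℕ i
... | yes α≤i = (fromℕ< k<m , s) ,
  trans (toℕ-dC i s k<m s) (trans (cong (arc m ∣ toℕ i - k ∣) (xor-same s))
    (trans (cong ∣_- k ∣ (sym i≡)) (∣m+n-m∣≡n k α))) ,
  trans (toℕ-dC j (not s) k<m s) (trans (cong (arc m ∣ toℕ j - k ∣) (trans (xor-comm (not s) s) (xor-not-self s)))
    (trans (cong (m ∸_) (trans (cong ∣_- k ∣ j≡k) (∣m+n-m∣≡n k (α + e))))
      (trans (cong (_∸ (α + e)) (trans (sym m≡) (lemma α β e))) (m+n∸n≡m β (α + e)))))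
  where
  k = toℕ i ∸ α
  k<m : k < m
  k<m = ≤-<-trans (m∸n≤m (toℕ i) α) (toℕ<n i)
  i≡ : k + α ≡ toℕ i
  i≡ = m∸n+n≡m α≤i
  j≡k : toℕ j ≡ k + (α + e)
  j≡k = trans j≡ (trans (cong (_+ e) (sym i≡)) (+-assoc k α e))
  lemma : ∀ α β e → α + β + e ≡ β + (α + e)
  lemma = solve-∀
... | no α≰i = (fromℕ< k<m , not s) ,
  trans (toℕ-dC i s k<m (not s)) (trans (cong (arc m ∣ toℕ i - k ∣) (xor-not-self s))
    (trans (cong (m ∸_) (trans (cong ∣ toℕ i -_∣ k≡) (∣m-m+n∣≡n (toℕ i) (e + β))))
      (trans (cong (_∸ (e + β)) (trans (sym m≡) (lemma α β e))) (m+n∸n≡m α (e + β))))) ,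
  trans (toℕ-dC j (not s) k<m (not s)) (trans (cong (arc m ∣ toℕ j - k ∣) (xor-same (not s)))
    (∣m-m+n∣≡n (toℕ j) β))
  where
  k = toℕ j + β
  k≡ : k ≡ toℕ i + (e + β)
  k≡ = trans (cong (_+ β) j≡) (+-assoc (toℕ i) e β)
  lemma : ∀ α β e → α + β + e ≡ α + (e + β)
  lemma = solve-∀
  k<m : k < m
  k<m = subst₂ _<_ (sym k≡) (trans (sym (lemma α β e)) m≡) (+-monoˡ-< (e + β) (≰⇒> α≰i))

between-≤ : ∀ {m} (X Y : Cyc m) {α β} → toℕ (proj₁ X) ≤ toℕ (proj₁ Y) → dC X Y ≡ α + β → Between X Y α β
between-≤ {m} (i , s) (j , t) {α} {β} i≤j d≡ = go s t d≡
  where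
  e = toℕ j ∸ toℕ i
  j≡ : toℕ j ≡ toℕ i + e
  j≡ = sym (m+[n∸m]≡n i≤j)
  ∣ij∣≡ : ∣ toℕ i - toℕ j ∣ ≡ e
  ∣ij∣≡ = m≤n⇒∣m-n∣≡n∸m i≤j
  same : ∣ toℕ i - toℕ j ∣ ≡ α + β → toℕ j ≡ toℕ i + (α + β)
  same eq = trans j≡ (cong (toℕ i +_) (trans (sym ∣ij∣≡) eq))
  opposite : m ∸ ∣ toℕ i - toℕ j ∣ ≡ α + β → α + β + e ≡ m
  opposite eq = trans (cong₂ _+_ (sym eq) (sym ∣ij∣≡)) (m∸n+n≡m (gap≤ i j))
  go : ∀ s t → dC (i , s) (j , t) ≡ α + β → Between (i , s) (j , t) α β
  go false false eq = between-same i j false (same eq)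
  go true  true  eq = between-same i j true (same eq)
  go false true  eq = between-opposite i j false j≡ (opposite eq)
  go true  false eq = between-opposite i j true j≡ (opposite eq)

between : ∀ {m} (X Y : Cyc m) {α β} → dC X Y ≡ α + β → Between X Y α β
between X Y {α} {β} eq with ≤-total (toℕ (proj₁ X)) (toℕ (proj₁ Y))
... | inj₁ X≤Y = between-≤ X Y X≤Y eq
... | inj₂ Y≤X with between-≤ Y X Y≤X (trans (dC-sym Y X) (trans eq (+-comm α β)))
...   | Z , p , q = Z , q , p

-- For points X, Y, Z write d(X,Y) = α + β, d(X,Z) = α + γ, d(Y,Z) = β + γ and let
-- α + β + γ + δ be the diameter.  On a cycle one of the four numbers vanishes.
Degenerate : ℕ → ℕ → ℕ → ℕ → Set
Degenerate α β γ δ = (α ≡ 0 ⊎ β ≡ 0) ⊎ (γ ≡ 0 ⊎ δ ≡ 0)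

flip-complement : ∀ {m} (X Y : Cyc m) {k l} → dC X Y ≡ k → k + l ≡ m → dC X (flip Y) ≡ l
flip-complement X Y {k} {l} d≡k k+l≡m =
  +-cancelˡ-≡ k _ _ (trans (cong (_+ dC X (flip Y)) (sym d≡k)) (trans (dC-flip X Y) (sym k+l≡m)))

dC-flipˡ : ∀ {m} (X Y : Cyc m) → dC (flip X) Y ≡ dC X (flip Y)
dC-flipˡ {m} (i , s) (j , t) = cong (arc m ∣ toℕ i - toℕ j ∣) (trans (sym (not-distribˡ-xor s t)) (not-distribʳ-xor s t))

-- Each vanishing number puts a point on a geodesic, up to antipodes: Z between X and Y for γ = 0,
-- the antipode of Z between X and Y for δ = 0, Z between X and the antipode of Y for α = 0, and
-- both antipodes for β = 0.
place-cycle : ∀ {m} (X Y : Cyc m) {α β γ δ} → dC X Y ≡ α + β → dC X (flip Y) ≡ γ + δ →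
  Degenerate α β γ δ → Between X Y (α + γ) (β + γ)
place-cycle {m} X Y {α} {β} {γ} {δ} d d′ deg = go deg
  where
  total : (α + β) + (γ + δ) ≡ m
  total = trans (cong₂ _+_ (sym d) (sym d′)) (dC-flip X Y)
  go : Degenerate α β γ δ → Between X Y (α + γ) (β + γ)
  go (inj₂ (inj₁ refl)) with between X Y d
  ... | Z , p , q = Z , trans p (sym (+-identityʳ α)) , trans q (sym (+-identityʳ β))
  go (inj₂ (inj₂ refl)) with between X Y {β} {α} (trans d (+-comm α β))
  ... | Z , p , q = flip Z , flip-complement X Z p (trans (lemma₁ α β γ) total) , flip-complement Y Z q (trans (lemma₂ α β γ) total)
    where
    lemma₁ : ∀ α β γ → β + (α + γ) ≡ (α + β) + (γ + 0)
    lemma₁ = solve-∀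
    lemma₂ : ∀ α β γ → α + (β + γ) ≡ (α + β) + (γ + 0)
    lemma₂ = solve-∀
  go (inj₁ (inj₁ refl)) with between X (flip Y) d′
  ... | Z , p , q = Z , p , trans (cong (λ W → dC W Z) (sym flip²)) (trans (dC-flipˡ (flip Y) Z) (flip-complement (flip Y) Z q (trans (lemma β γ δ) total)))
    where
    flip² : flip (flip Y) ≡ Y
    flip² = cong (proj₁ Y ,_) (not-involutive (proj₂ Y))
    lemma : ∀ β γ δ → δ + (β + γ) ≡ β + (γ + δ)
    lemma = solve-∀
  go (inj₁ (inj₂ refl)) with between X (flip Y) (trans d′ (+-comm γ δ))
  ... | Z , p , q = flip Z , flip-complement X Z p (trans (lemma α γ δ) total) , trans (sym (dC-flipˡ Y Z)) q
    where
    lemma : ∀ α γ δ → δ + (α + γ) ≡ α + 0 + (γ + δ)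
    lemma = solve-∀

-- Here x and y are the distances in the first and the second cycle; the subscripts tell which cycle
-- receives which part of α and β.
data Split (x y α β : ℕ) : ℕ → ℕ → ℕ → ℕ → Set where
  split : ∀ {α₁ α₂ β₁ β₂} → α₁ + α₂ ≡ α → β₁ + β₂ ≡ β → x ≡ α₁ + β₁ → y ≡ α₂ + β₂ → Split x y α β α₁ α₂ β₁ β₂

Splitˡ Splitʳ : ℕ → ℕ → ℕ → ℕ → Set
Splitˡ x y α β = ∃ λ α₁ → ∃ λ α₂ → ∃ λ β₁ → ∃ λ β₂ → Split x y α β α₁ α₂ β₁ β₂ × (α₁ ≡ 0 ⊎ β₁ ≡ 0)
Splitʳ x y α β = ∃ λ α₁ → ∃ λ α₂ → ∃ λ β₁ → ∃ λ β₂ → Split x y α β α₁ α₂ β₁ β₂ × (α₂ ≡ 0 ⊎ β₂ ≡ 0)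

-- A zero in the first cycle arises by putting all of α into y, or by taking all of x out of α. Both
-- fail only if y < α < x.
splitˡ : ∀ x y α β → x + y ≡ α + β → Splitˡ x y α β ⊎ 2 + y ≤ x
splitˡ x y α β eq with α ≤? y | x ≤? α
... | yes α≤y | _ = inj₁ (0 , α , x , y ∸ α ,
  split refl (+-cancelˡ-≡ α _ _ (trans (lemma α x (y ∸ α)) (trans (cong (x +_) (m+[n∸m]≡n α≤y)) eq))) refl (sym (m+[n∸m]≡n α≤y)) , inj₁ refl)
  where
  lemma : ∀ α x k → α + (x + k) ≡ x + (α + k)
  lemma = solve-∀
... | no _ | yes x≤α = inj₁ (x , α ∸ x , 0 , β ,
  split (m+[n∸m]≡n x≤α) refl (sym (+-identityʳ x))
    (+-cancelˡ-≡ x _ _ (trans eq (trans (cong (_+ β) (sym (m+[n∸m]≡n x≤α))) (+-assoc x (α ∸ x) β)))) , inj₂ refl)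
... | no α≰y | no x≰α = inj₂ (≤-trans (s≤s (≰⇒> α≰y)) (≰⇒> x≰α))

splitʳ : ∀ x y α β → x + y ≡ α + β → Splitʳ x y α β ⊎ 2 + x ≤ y
splitʳ x y α β eq with splitˡ y x α β (trans (+-comm y x) eq)
... | inj₁ (α₂ , α₁ , β₂ , β₁ , split p q r s , d) =
  inj₁ (α₁ , α₂ , β₁ , β₂ , split (trans (+-comm α₁ α₂) p) (trans (+-comm β₁ β₂) q) s r , d)
... | inj₂ lt = inj₂ lt

-- α + β and γ + δ are distributed over two cycles so that both parts are degenerate.  One pair can
-- be split with a zero in the first cycle and the other with a zero in the second one, unless the
-- cycles differ by more than 1 in half-length.
not-far : ∀ a b → ¬ (2 + a + (2 + b) ≤ suc (a + b))
not-far a b le rewrite +-suc a (suc b) | +-suc a b = <⇒≱ (s≤s (≤-trans (n≤1+n _) (n≤1+n _))) le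

DegenerateSplit : ℕ → ℕ → ℕ → ℕ → ℕ → ℕ → ℕ → ℕ → Set
DegenerateSplit x y x′ y′ α β γ δ = (Splitˡ x y α β × Splitʳ x′ y′ γ δ) ⊎ (Splitʳ x y α β × Splitˡ x′ y′ γ δ)

degenerate-split : ∀ {x y x′ y′ α β γ δ} → x + y ≡ α + β → x′ + y′ ≡ γ + δ →
  x + x′ ≤ suc (y + y′) → y + y′ ≤ suc (x + x′) → DegenerateSplit x y x′ y′ α β γ δ
degenerate-split {x} {y} {x′} {y′} {α} {β} {γ} {δ} eq eq′ ≤₁ ≤₂
  with splitˡ x y α β eq | splitʳ x′ y′ γ δ eq′ | splitʳ x y α β eq | splitˡ x′ y′ γ δ eq′
... | inj₁ l | inj₁ r | _      | _      = inj₁ (l , r)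
... | _      | _      | inj₁ r | inj₁ l = inj₂ (r , l)
... | inj₂ p | _      | inj₂ q | _      = contradiction (≤-trans (m≤n+m x 2) q) (<⇒≱ (≤-trans (n≤1+n (suc y)) p))
... | _      | inj₂ p | _      | inj₂ q = contradiction (≤-trans (m≤n+m x′ 2) p) (<⇒≱ (≤-trans (n≤1+n (suc y′)) q))
... | inj₂ p | _      | _      | inj₂ q = contradiction (≤-trans (+-mono-≤ p q) ≤₁) (not-far y y′)
... | _      | inj₂ p | inj₂ q | _      = contradiction (≤-trans (+-mono-≤ q p) ≤₂) (not-far x x′)

-- The torus C_2a □ C_2b with its antipodal map

Torus : ℕ → ℕ → Set
Torus a b = Cyc a × Cyc b

antipode : ∀ {a b} → Torus a b → Torus a b
antipode (X , Y) = flip X , flip Y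

dT : ∀ {a b} → Torus a b → Torus a b → ℕ
dT (X , Y) (X′ , Y′) = dC X X′ + dC Y Y′

dT-refl : ∀ {a b} (P : Torus a b) → dT P P ≡ 0
dT-refl (X , Y) = cong₂ _+_ (dC-refl X) (dC-refl Y)

dT-sym : ∀ {a b} (P Q : Torus a b) → dT P Q ≡ dT Q P
dT-sym (X , Y) (X′ , Y′) = cong₂ _+_ (dC-sym X X′) (dC-sym Y Y′)

+-interchange : ∀ m n o p → (m + n) + (o + p) ≡ (m + o) + (n + p)
+-interchange = solve-∀

dT-antipode : ∀ {a b} (P Q : Torus a b) → dT P Q + dT P (antipode Q) ≡ a + b
dT-antipode (X , Y) (X′ , Y′) =
  trans (+-interchange (dC X X′) (dC Y Y′) _ _) (cong₂ _+_ (dC-flip X X′) (dC-flip Y Y′))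

dT-antipodes : ∀ {a b} (P Q : Torus a b) → dT (antipode P) (antipode Q) ≡ dT P Q
dT-antipodes (X , Y) (X′ , Y′) = cong₂ _+_ (dC-flip-flip X X′) (dC-flip-flip Y Y′)

dT-triangle : ∀ {a b} (P Q R : Torus a b) → dT P R ≤ dT P Q + dT Q R
dT-triangle (X , Y) (X′ , Y′) (X″ , Y″) =
  ≤-trans (+-mono-≤ (dC-triangle X X′ X″) (dC-triangle Y Y′ Y″))
    (≤-reflexive (+-interchange (dC X X′) (dC X′ X″) _ _))

-- The splitting makes the coordinates independent: each cycle receives a quadruple that adds up to
-- its own half-length and contains a zero, so `place-cycle` applies in both.
place-torus : ∀ {a b} → a ≤ suc b → b ≤ suc a → (P Q : Torus a b) → ∀ {α β γ δ} →
  dT P Q ≡ α + β → α + β + (γ + δ) ≡ a + b → ∃ λ R → dT P R ≡ α + γ × dT Q R ≡ β + γ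
place-torus {a} {b} a≤ b≤ P@(X , Y) Q@(X′ , Y′) {α} {β} {γ} {δ} d total =
  go (degenerate-split {x} {y} {x′} {y′} {α} {β} {γ} {δ} d d′
       (subst₂ (λ m n → m ≤ suc n) (sym (dC-flip X X′)) (sym (dC-flip Y Y′)) a≤)
       (subst₂ (λ m n → n ≤ suc m) (sym (dC-flip X X′)) (sym (dC-flip Y Y′)) b≤))
  where
  x = dC X X′
  x′ = dC X (flip X′)
  y = dC Y Y′
  y′ = dC Y (flip Y′)
  d′ : x′ + y′ ≡ γ + δ
  d′ = +-cancelˡ-≡ (α + β) _ _ (trans (cong (_+ (x′ + y′)) (sym d)) (trans (dT-antipode P Q) (sym total)))
  glue : ∀ {α₁ α₂ β₁ β₂ γ₁ γ₂ δ₁ δ₂} → Split x y α β α₁ α₂ β₁ β₂ → Split x′ y′ γ δ γ₁ γ₂ δ₁ δ₂ →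
    Degenerate α₁ β₁ γ₁ δ₁ → Degenerate α₂ β₂ γ₂ δ₂ → ∃ λ R → dT P R ≡ α + γ × dT Q R ≡ β + γ
  glue {α₁} {α₂} {β₁} {β₂} {γ₁} {γ₂} (split refl refl ex ey) (split refl refl ex′ ey′) deg₁ deg₂
    with place-cycle X X′ ex ex′ deg₁ | place-cycle Y Y′ ey ey′ deg₂
  ... | Z , p , q | W , p′ , q′ = (Z , W) ,
    trans (cong₂ _+_ p p′) (+-interchange α₁ γ₁ α₂ γ₂) , trans (cong₂ _+_ q q′) (+-interchange β₁ γ₁ β₂ γ₂)
  go : DegenerateSplit x y x′ y′ α β γ δ → ∃ λ R → dT P R ≡ α + γ × dT Q R ≡ β + γ
  go (inj₁ ((_ , _ , _ , _ , s , e) , (_ , _ , _ , _ , s′ , e′))) = glue s s′ (inj₁ e) (inj₂ e′)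
  go (inj₂ ((_ , _ , _ , _ , s , e) , (_ , _ , _ , _ , s′ , e′))) = glue s s′ (inj₂ e′) (inj₁ e)

-- Triples of distances with even perimeter

halve : ∀ k → odd k ≡ false → ∃ λ h → k ≡ h + h
halve zero _ = 0 , refl
halve (suc (suc k)) e with halve k (trans (sym (not-involutive (odd k))) e)
... | h , refl = suc h , cong suc (sym (+-suc h h))

+-double-injective : ∀ m n → m + m ≡ n + n → m ≡ n
+-double-injective m n eq = *-cancelˡ-≡ m n 2 (trans (lemma m) (trans eq (sym (lemma n))))
  where
  lemma : ∀ m → 2 * m ≡ m + m
  lemma = solve-∀

-- α, β, γ are the Gromov products of the triple, the legs from the three points to a virtual
-- centre; δ is g minus half the perimeter.
record Tripod (p q r g : ℕ) : Set where
  constructor tripod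
  field
    {α β γ δ} : ℕ
    p≡ : p ≡ α + β
    q≡ : q ≡ α + γ
    r≡ : r ≡ β + γ
    g≡ : α + β + (γ + δ) ≡ g

-- The legs are half the excesses in the triangle inequalities, and δ is half the excess in the
-- perimeter bound. Every excess is even because it has the parity of the perimeter.
tripod-of : ∀ {p q r g} → p ≤ q + r → q ≤ p + r → r ≤ p + q → p + q + r ≤ g + g →
  odd (p + q + r) ≡ false → Tripod p q r g
tripod-of {p} {q} {r} {g} p≤ q≤ r≤ per even
  with excess {p + q} {r} r≤ even
     | excess {p + r} {q} q≤ (trans (cong odd (swap p r q)) even)
     | excess {q + r} {p} p≤ (trans (cong odd (rotate q r p)) even)
     | excess {g + g} {p + q + r} per (trans (odd-+ (g + g) (p + q + r)) (cong₂ _xor_ (trans (odd-+ g g) (xor-same (odd g))) even))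
  where
  excess : ∀ {m n} → n ≤ m → odd (m + n) ≡ false → ∃ λ h → m ≡ n + (h + h)
  excess {m} {n} n≤m e with halve (m ∸ n) (trans (odd-∸ n≤m) (trans (sym (odd-+ m n)) e))
  ... | h , eq = h , trans (sym (m+[n∸m]≡n n≤m)) (cong (n +_) eq)
  swap : ∀ p r q → p + r + q ≡ p + q + r
  swap = solve-∀
  rotate : ∀ q r p → q + r + p ≡ p + q + r
  rotate = solve-∀
... | α , pq | β , pr | γ , qr | δ , gg = tripod {α = α} {β} {γ} {δ} p≡ q≡ r≡ (+-double-injective _ _ (trans double (sym gg)))
  where
  half : ∀ {p q r} α β → p + q ≡ r + (α + α) → p + r ≡ q + (β + β) → p ≡ α + β
  half {p} {q} {r} α β e e′ = +-double-injective _ _ (+-cancelʳ-≡ (q + r) _ _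
    (trans (lhs p q r) (trans (cong₂ _+_ e e′) (rhs q r α β))))
    where
    lhs : ∀ p q r → p + p + (q + r) ≡ p + q + (p + r)
    lhs = solve-∀
    rhs : ∀ q r α β → r + (α + α) + (q + (β + β)) ≡ (α + β) + (α + β) + (q + r)
    rhs = solve-∀
  p≡ : p ≡ α + β
  p≡ = half α β pq pr
  q≡ : q ≡ α + γ
  q≡ = half α γ (trans (+-comm q p) pq) qr
  r≡ : r ≡ β + γ
  r≡ = half β γ (trans (+-comm r p) pr) (trans (+-comm r q) qr)
  double : (α + β + (γ + δ)) + (α + β + (γ + δ)) ≡ p + q + r + (δ + δ)
  double = trans (lemma α β γ δ) (cong (_+ (δ + δ)) (sym (cong₂ _+_ (cong₂ _+_ p≡ q≡) r≡)))
    where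
    lemma : ∀ α β γ δ → (α + β + (γ + δ)) + (α + β + (γ + δ)) ≡ (α + β) + (α + γ) + (β + γ) + (δ + δ)
    lemma = solve-∀

-- Signed metrics

-- D u v s is the distance from u to v along walks of sign s.
SignedDistance : Set → Set
SignedDistance V = V → V → Bool → ℕ

_≼_ : ∀ {V} → SignedDistance V → SignedDistance V → Set
D′ ≼ D = ∀ u v s → D′ u v s ≤ D u v s

-- These are metric axioms on the signed double cover, where (u , s) and (v , t) have distance
-- `D u v (s xor t)`: the two copies of a vertex are g apart, and no distance exceeds g. By
-- `parity`, positive distances are even exactly between vertices of equal colour.
record SignedMetric {V : Set} (g : ℕ) (c : V → Bool) (D : SignedDistance V) : Set where
  field
    reflexive : ∀ u → D u u false ≡ 0
    antipodal : ∀ u → D u u true ≡ g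
    symmetric : ∀ u v s → D u v s ≡ D v u s
    triangle  : ∀ u v w s t → D u w (s xor t) ≤ D u v s + D v w t
    parity    : ∀ u v s → odd (D u v s) ≡ (c u xor c v) xor (s ∧ odd g)
    bounded   : ∀ u v s → D u v s ≤ g

-- Adds an edge xy of sign s and length ℓ to a signed metric.
module Relax {V : Set} {g : ℕ} {c : V → Bool} {D : SignedDistance V} (M : SignedMetric g c D)
             (x y : V) (s : Bool) (ℓ : ℕ)
             (ℓ-large : g ≤ ℓ + D y x (not s))
             (ℓ-parity : odd ℓ ≡ (c x xor c y) xor (s ∧ odd g)) where
  open SignedMetric M

  src tgt : Bool → V
  src false = x
  src true  = y
  tgt false = y
  tgt true  = x

  -- Shortest walks pass the new edge at most once; `o` is the direction of that passage, α and β
  -- are the signs of the parts before and after it.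
  data Route (u v : V) (t : Bool) (k : ℕ) : Set where
    direct : k ≡ D u v t → Route u v t k
    via    : ∀ o α β → t ≡ α xor (s xor β) → k ≡ D u (src o) α + ℓ + D (tgt o) v β → Route u v t k

  detour : V → V → Bool → Bool → Bool → ℕ
  detour u v t o α = D u (src o) α + ℓ + D (tgt o) v (α xor (s xor t))

  relax : SignedDistance V
  relax u v t = D u v t ⊓ ((detour u v t false false ⊓ detour u v t false true) ⊓
                           (detour u v t true false ⊓ detour u v t true true))

  relax-≼ : relax ≼ D
  relax-≼ u v t = m⊓n≤m (D u v t) _

  route : ∀ u v t → Route u v t (relax u v t)
  route u v t with ⊓-sel (D u v t) ((detour u v t false false ⊓ detour u v t false true) ⊓
                           (detour u v t true false ⊓ detour u v t true true))
  ... | inj₁ eq = direct eq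
  ... | inj₂ eq = pick₂ eq
    where
    by : ∀ {k} o α → k ≡ detour u v t o α → Route u v t k
    by o α = via o α (α xor (s xor t)) (lemma t s α)
      where
      open xor-∧-Solver
      lemma : ∀ t s α → t ≡ α xor (s xor (α xor (s xor t)))
      lemma = solve 3 (λ t s α → t := α :+ (s :+ (α :+ (s :+ t)))) refl
    pick₁ : ∀ {k} o → k ≡ detour u v t o false ⊓ detour u v t o true → Route u v t k
    pick₁ o eq with ⊓-sel (detour u v t o false) (detour u v t o true)
    ... | inj₁ eq′ = by o false (trans eq eq′)
    ... | inj₂ eq′ = by o true (trans eq eq′)
    pick₂ : ∀ {k} → k ≡ (detour u v t false false ⊓ detour u v t false true) ⊓
                    (detour u v t true false ⊓ detour u v t true true) → Route u v t k
    pick₂ eq with ⊓-sel (detour u v t false false ⊓ detour u v t false true) (detour u v t true false ⊓ detour u v t true true)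
    ... | inj₁ eq′ = pick₁ false (trans eq eq′)
    ... | inj₂ eq′ = pick₁ true (trans eq eq′)

  relax≤detour : ∀ u v t o α → relax u v t ≤ detour u v t o α
  relax≤detour u v t o α = ≤-trans (m⊓n≤n (D u v t) _) (go o α)
    where
    go : ∀ o α → (detour u v t false false ⊓ detour u v t false true) ⊓
                 (detour u v t true false ⊓ detour u v t true true) ≤ detour u v t o α
    go false false = ≤-trans (m⊓n≤m _ _) (m⊓n≤m _ _)
    go false true  = ≤-trans (m⊓n≤m _ _) (m⊓n≤n _ _)
    go true  false = ≤-trans (m⊓n≤n _ _) (m⊓n≤m _ _)
    go true  true  = ≤-trans (m⊓n≤n _ _) (m⊓n≤n _ _)

  relax≤via : ∀ {t} u v o α β → t ≡ α xor (s xor β) → relax u v t ≤ D u (src o) α + ℓ + D (tgt o) v β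
  relax≤via {t} u v o α β eq =
    subst (λ b → relax u v t ≤ D u (src o) α + ℓ + D (tgt o) v b) (trans (cong (λ t → α xor (s xor t)) eq) (lemma α s β)) (relax≤detour u v t o α)
    where
    open xor-∧-Solver
    lemma : ∀ α s β → α xor (s xor (α xor (s xor β))) ≡ β
    lemma = solve 3 (λ α s β → α :+ (s :+ (α :+ (s :+ β))) := β) refl

  relax≤route : ∀ {u v t k} → Route u v t k → relax u v t ≤ k
  relax≤route (direct refl) = relax-≼ _ _ _
  relax≤route (via o α β eq refl) = relax≤via _ _ o α β eq

  relax-edge : relax x y s ≤ ℓ
  relax-edge = ≤-trans (relax≤via x y false false false (sym (xor-identityʳ s)))
    (≤-reflexive (trans (cong₂ (λ p q → p + ℓ + q) (reflexive x) (reflexive y)) (+-identityʳ ℓ)))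

  ℓ-large-both : ∀ o → g ≤ ℓ + D (tgt o) (src o) (not s)
  ℓ-large-both false = ℓ-large
  ℓ-large-both true  = subst (λ d → g ≤ ℓ + d) (symmetric y x (not s)) ℓ-large

  ℓ-parity-both : ∀ o → odd ℓ ≡ (c (src o) xor c (tgt o)) xor (s ∧ odd g)
  ℓ-parity-both false = ℓ-parity
  ℓ-parity-both true  = trans ℓ-parity (cong (_xor (s ∧ odd g)) (xor-comm (c x) (c y)))

  reverse : ∀ {u v t k} → Route u v t k → Route v u t k
  reverse {u} {v} {t} (direct eq) = direct (trans eq (symmetric u v t))
  reverse {u} {v} (via o α β eq eq′) = via (not o) β α (trans eq (lemma α s β)) (trans eq′ (go o))
    where
    open xor-∧-Solver
    lemma : ∀ α s β → α xor (s xor β) ≡ β xor (s xor α)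
    lemma = solve 3 (λ α s β → α :+ (s :+ β) := β :+ (s :+ α)) refl
    mirror : ∀ p l q → p + l + q ≡ q + l + p
    mirror = solve-∀
    go : ∀ o → D u (src o) α + ℓ + D (tgt o) v β ≡ D v (src (not o)) β + ℓ + D (tgt (not o)) u α
    go false = trans (mirror (D u x α) ℓ (D y v β)) (cong₂ (λ p q → p + ℓ + q) (symmetric _ _ _) (symmetric _ _ _))
    go true  = trans (mirror (D u y α) ℓ (D x v β)) (cong₂ (λ p q → p + ℓ + q) (symmetric _ _ _) (symmetric _ _ _))

  relax-symmetric : ∀ u v t → relax u v t ≡ relax v u t
  relax-symmetric u v t = ≤-antisym (relax≤route (reverse (route v u t))) (relax≤route (reverse (route u v t)))

  relax-parity : ∀ {u v t k} → Route u v t k → odd k ≡ (c u xor c v) xor (t ∧ odd g)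
  relax-parity (direct refl) = parity _ _ _
  relax-parity {u} {v} (via o α β refl refl) = begin
    odd (D u (src o) α + ℓ + D (tgt o) v β)                           ≡⟨ odd-+ (D u (src o) α + ℓ) _ ⟩
    odd (D u (src o) α + ℓ) xor odd (D (tgt o) v β)                   ≡⟨ cong (_xor _) (odd-+ (D u (src o) α) ℓ) ⟩
    (odd (D u (src o) α) xor odd ℓ) xor odd (D (tgt o) v β)           ≡⟨ cong₂ _xor_ (cong₂ _xor_ (parity _ _ _) (ℓ-parity-both o)) (parity _ _ _) ⟩
    (((c u xor c (src o)) xor (α ∧ odd g)) xor ((c (src o) xor c (tgt o)) xor (s ∧ odd g))) xor ((c (tgt o) xor c v) xor (β ∧ odd g))
                                                                      ≡⟨ lemma (c u) (c (src o)) (c (tgt o)) (c v) α s β (odd g) ⟩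
    (c u xor c v) xor ((α xor (s xor β)) ∧ odd g)                     ∎
    where
    open ≡-Reasoning
    open xor-∧-Solver
    lemma : ∀ u x y v α s β g → (((u xor x) xor (α ∧ g)) xor ((x xor y) xor (s ∧ g))) xor ((y xor v) xor (β ∧ g))
            ≡ (u xor v) xor ((α xor (s xor β)) ∧ g)
    lemma = solve 8 (λ u x y v α s β g → (((u :+ x) :+ (α :* g)) :+ ((x :+ y) :+ (s :* g))) :+ ((y :+ v) :+ (β :* g))
            := (u :+ v) :+ ((α :+ (s :+ β)) :* g)) refl

  -- A negative closed route over the new edge, opened at that edge, runs from `tgt o` to `src o`
  -- with sign `not s`, and `ℓ-large` bounds exactly such walks.
  antipodal≤ : ∀ {u k} → Route u u true k → g ≤ k
  antipodal≤ {u} (direct refl) = ≤-reflexive (sym (antipodal u))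
  antipodal≤ {u} (via o α β eq refl) = begin
    g                                              ≤⟨ ℓ-large-both o ⟩
    ℓ + D (tgt o) (src o) (not s)                  ≡⟨ cong (λ r → ℓ + D (tgt o) (src o) r) (sym r≡) ⟩
    ℓ + D (tgt o) (src o) (β xor α)                ≤⟨ +-monoʳ-≤ ℓ (triangle _ u _ β α) ⟩
    ℓ + (D (tgt o) u β + D u (src o) α)            ≡⟨ lemma ℓ (D (tgt o) u β) (D u (src o) α) ⟩
    D u (src o) α + ℓ + D (tgt o) u β              ∎
    where
    open ≤-Reasoning
    open xor-∧-Solver
    lemma : ∀ ℓ p q → ℓ + (p + q) ≡ q + ℓ + p
    lemma = solve-∀
    r≡ : β xor α ≡ not s
    r≡ = trans (solve 3 (λ α s β → β :+ α := s :+ (α :+ (s :+ β))) refl α s β) (trans (cong (s xor_) (sym eq)) (xor-comm s true))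

  D-not : ∀ u v t → D u v (not t) ≤ D u v t + g
  D-not u v t = subst₂ _≤_ (cong (D u v) (xor-comm t true)) (cong (D u v t +_) (antipodal v)) (triangle u v v t true)

  -- Two routes in succession pass the new edge up to twice. The work is to replace two passages by
  -- one or by none without increasing the length or altering the sign.
  relax-triangle : ∀ {u v w p q k l} → Route u v p k → Route v w q l → relax u w (p xor q) ≤ k + l
  relax-triangle {u} {v} {w} {p} {q} (direct refl) (direct refl) = ≤-trans (relax-≼ u w _) (triangle u v w p q)
  relax-triangle {u} {v} {w} {p} (direct refl) (via o α β refl refl) =
    ≤-trans (relax≤via u w o (p xor α) β (sym (xor-assoc p α _)))
      (≤-trans (+-monoˡ-≤ (D (tgt o) w β) (+-monoˡ-≤ ℓ (triangle u v (src o) p α)))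
        (≤-reflexive (lemma (D u v p) (D v (src o) α) ℓ (D (tgt o) w β))))
    where
    lemma : ∀ a b ℓ d → a + b + ℓ + d ≡ a + (b + ℓ + d)
    lemma = solve-∀
  relax-triangle {u} {v} {w} {q = q} (via o α β refl refl) (direct refl) =
    ≤-trans (relax≤via u w o α (β xor q) (lemma′ α s β q))
      (≤-trans (+-monoʳ-≤ (D u (src o) α + ℓ) (triangle (tgt o) v w β q))
        (≤-reflexive (sym (+-assoc (D u (src o) α + ℓ) (D (tgt o) v β) (D v w q)))))
    where
    open xor-∧-Solver
    lemma′ : ∀ α s β q → (α xor (s xor β)) xor q ≡ α xor (s xor (β xor q))
    lemma′ = solve 4 (λ α s β q → (α :+ (s :+ β)) :+ q := α :+ (s :+ (β :+ q))) refl
  relax-triangle {u} {v} {w} (via o α β refl refl) (via o′ α′ β′ refl refl) = cases o o′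
    where
    open xor-∧-Solver
    r = β xor α′
    middle : ∀ x y → D x y r ≤ D x v β + D v y α′
    middle x y = triangle x v y β α′
    total : (α xor (s xor β)) xor (α′ xor (s xor β′)) ≡ α xor (r xor β′)
    total = solve 5 (λ α s β α′ β′ → (α :+ (s :+ β)) :+ (α′ :+ (s :+ β′)) := α :+ ((β :+ α′) :+ β′)) refl α s β α′ β′
    Goal : Bool → Bool → Set
    Goal o o′ = relax u w ((α xor (s xor β)) xor (α′ xor (s xor β′))) ≤
      D u (src o) α + ℓ + D (tgt o) v β + (D v (src o′) α′ + ℓ + D (tgt o′) w β′)

    -- Two passages in the same direction: the part in between either has the sign of the
    -- new edge, and then one passage suffices, or it closes the edge to a negative walk.
    same : ∀ o → Goal o o
    same o with r ≟ᵇ s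
    ... | yes r≡s = begin
      relax u w _                            ≤⟨ relax≤via u w o α β′ (trans total (cong (λ r → α xor (r xor β′)) r≡s)) ⟩
      A + ℓ + B                              ≤⟨ m≤m+n (A + ℓ + B) (C + (F + ℓ)) ⟩
      A + ℓ + B + (C + (F + ℓ))              ≡⟨ lemma A ℓ B C F ⟩
      A + ℓ + C + (F + ℓ + B)                ∎
      where
      open ≤-Reasoning
      A = D u (src o) α
      B = D (tgt o) w β′
      C = D (tgt o) v β
      F = D v (src o) α′
      lemma : ∀ A ℓ B C F → A + ℓ + B + (C + (F + ℓ)) ≡ A + ℓ + C + (F + ℓ + B)
      lemma = solve-∀
    ... | no r≢s = begin
      relax u w _                            ≤⟨ relax≤via u w o (not α) β′ (trans total (trans (cong (λ r → α xor (r xor β′)) r≡) (lemma′ α s β′))) ⟩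
      D u (src o) (not α) + ℓ + B            ≤⟨ +-monoˡ-≤ B (+-monoˡ-≤ ℓ (D-not u (src o) α)) ⟩
      A + g + ℓ + B                          ≤⟨ +-monoˡ-≤ B (+-monoˡ-≤ ℓ (+-monoʳ-≤ A
                                                  (≤-trans (ℓ-large-both o) (+-monoʳ-≤ ℓ (subst (λ r → D (tgt o) (src o) r ≤ C + F) r≡ (middle (tgt o) (src o))))))) ⟩
      A + (ℓ + (C + F)) + ℓ + B              ≡⟨ lemma A ℓ B C F ⟩
      A + ℓ + C + (F + ℓ + B)                ∎
      where
      open ≤-Reasoning
      A = D u (src o) α
      B = D (tgt o) w β′
      C = D (tgt o) v β
      F = D v (src o) α′
      r≡ : r ≡ not s
      r≡ = ¬-not r≢s
    
      lemma : ∀ A ℓ B C F → A + (ℓ + (C + F)) + ℓ + B ≡ A + ℓ + C + (F + ℓ + B)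
      lemma = solve-∀
      lemma′ : ∀ α s β → α xor (not s xor β) ≡ not α xor (s xor β)
      lemma′ α s β = trans (cong (α xor_) (sym (not-distribˡ-xor s β)))
        (trans (sym (not-distribʳ-xor α (s xor β))) (not-distribˡ-xor α (s xor β)))

    opposite : ∀ x y → relax u w ((α xor (s xor β)) xor (α′ xor (s xor β′))) ≤
      D u x α + ℓ + D y v β + (D v y α′ + ℓ + D x w β′)
    opposite x y with r in r≡
    ... | false = begin
      relax u w _                            ≤⟨ relax-≼ u w _ ⟩
      D u w _                                ≡⟨ cong (D u w) (trans total (cong (λ r → α xor (r xor β′)) r≡)) ⟩
      D u w (α xor β′)                       ≤⟨ triangle u x w α β′ ⟩
      A + B                                  ≤⟨ m≤m+n (A + B) (ℓ + C + (F + ℓ)) ⟩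
      A + B + (ℓ + C + (F + ℓ))              ≡⟨ lemma A ℓ B C F ⟩
      A + ℓ + C + (F + ℓ + B)                ∎
      where
      open ≤-Reasoning
      A = D u x α
      B = D x w β′
      C = D y v β
      F = D v y α′
      lemma : ∀ A ℓ B C F → A + B + (ℓ + C + (F + ℓ)) ≡ A + ℓ + C + (F + ℓ + B)
      lemma = solve-∀
    ... | true = begin
      relax u w _                            ≤⟨ relax-≼ u w _ ⟩
      D u w _                                ≡⟨ cong (D u w) (trans total (trans (cong (λ r → α xor (r xor β′)) r≡)
                                                   (trans (sym (not-distribʳ-xor α β′)) (not-distribˡ-xor α β′)))) ⟩
      D u w (not α xor β′)                   ≤⟨ triangle u x w (not α) β′ ⟩
      D u x (not α) + B                      ≤⟨ +-monoˡ-≤ B (D-not u x α) ⟩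
      A + g + B                              ≤⟨ +-monoˡ-≤ B (+-monoʳ-≤ A (subst (_≤ C + F) (trans (cong (D y y) r≡) (antipodal y)) (middle y y))) ⟩
      A + (C + F) + B                        ≤⟨ m≤m+n (A + (C + F) + B) (ℓ + ℓ) ⟩
      A + (C + F) + B + (ℓ + ℓ)              ≡⟨ lemma A ℓ B C F ⟩
      A + ℓ + C + (F + ℓ + B)                ∎
      where
      open ≤-Reasoning
      A = D u x α
      B = D x w β′
      C = D y v β
      F = D v y α′
      lemma : ∀ A ℓ B C F → A + (C + F) + B + (ℓ + ℓ) ≡ A + ℓ + C + (F + ℓ + B)
      lemma = solve-∀

    cases : ∀ o o′ → Goal o o′
    cases false false = same false
    cases true  true  = same true
    cases false true  = opposite x y
    cases true  false = opposite y x

  relax-metric : SignedMetric g c relax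
  relax-metric = record
    { reflexive = λ u → n≤0⇒n≡0 (≤-trans (relax-≼ u u false) (≤-reflexive (reflexive u)))
    ; antipodal = λ u → ≤-antisym (≤-trans (relax-≼ u u true) (≤-reflexive (antipodal u))) (antipodal≤ (route u u true))
    ; symmetric = relax-symmetric
    ; triangle = λ u v w p q → relax-triangle (route u v p) (route v w q)
    ; parity = λ u v t → relax-parity (route u v t)
    ; bounded = λ u v t → ≤-trans (relax-≼ u v t) (bounded u v t)
    }

-- Shortening distances pair by pair

record Improvement {V : Set} (Inv : SignedDistance V → Set) (Done : SignedDistance V → Set) (D : SignedDistance V) : Set where
  constructor improvement
  field
    {distance} : SignedDistance V
    smaller    : distance ≼ D
    invariant  : Inv distance
    done       : Done distance

-- One pass suffices: a condition once achieved survives the later rounds, since these only decrease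
-- distances.
improve-all : ∀ {V} {Inv : SignedDistance V → Set} n {Done : Fin n → SignedDistance V → Set} →
  (∀ i {D D′} → D′ ≼ D → Done i D → Done i D′) →
  (∀ i {D} → Inv D → Improvement Inv (Done i) D) →
  ∀ {D} → Inv D → Improvement Inv (λ D → ∀ i → Done i D) D
improve-all zero _ _ inv = improvement (λ _ _ _ → ≤-refl) inv (λ ())
improve-all {V} (suc n) {Done} mono improve inv with improve zero inv
... | improvement D′≼D inv′ done with improve-all n (λ i → mono (suc i)) (λ i → improve (suc i)) inv′
...   | improvement {D″} D″≼D′ inv″ rest = improvement (λ u v s → ≤-trans (D″≼D′ u v s) (D′≼D u v s)) inv″ all
  where
  all : ∀ i → Done i D″
  all zero    = mono zero D″≼D′ done
  all (suc i) = rest i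

Tight : ∀ {V} → ℕ → V → V → SignedDistance V → Set
Tight g u v D = D u v false + D u v true ≤ g

Tight-mono : ∀ {V g} (u v : V) {D D′} → D′ ≼ D → Tight g u v D → Tight g u v D′
Tight-mono u v D′≼D = ≤-trans (+-mono-≤ (D′≼D u v false) (D′≼D u v true))

-- A negative edge uv of length g - D⁺(u , v) is the shortest one that `Relax` admits: its
-- hypothesis `ℓ-large` holds with equality.
tighten : ∀ {V g} {c : V → Bool} u v {D} → SignedMetric g c D → Improvement (SignedMetric g c) (Tight g u v) D
tighten {g = g} {c} u v {D} M = improvement relax-≼ relax-metric
  (≤-trans (+-mono-≤ (relax-≼ u v false) relax-edge) (≤-reflexive (m+[n∸m]≡n (bounded u v false))))
  where
  open SignedMetric M
  large : g ≤ g ∸ D u v false + D v u false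
  large = ≤-reflexive (trans (sym (m∸n+n≡m (bounded u v false))) (cong (g ∸ D u v false +_) (symmetric u v false)))
  ℓ-parity : odd (g ∸ D u v false) ≡ (c u xor c v) xor (true ∧ odd g)
  ℓ-parity = trans (odd-∸ (bounded u v false)) (trans (cong (odd g xor_) (parity u v false))
    (solve 2 (λ g c → g :+ (c :+ con false) := c :+ g) refl (odd g) (c u xor c v)))
    where open xor-∧-Solver
  open Relax M u v true (g ∸ D u v false) large ℓ-parity

tighten-all : ∀ {n g} {c : Fin n → Bool} {D} → SignedMetric g c D →
  Improvement (SignedMetric g c) (λ D → ∀ u v → Tight g u v D) D
tighten-all {n} M = improve-all n (λ u D′≼D tight v → Tight-mono u v D′≼D (tight v))
  (λ u → improve-all n (λ v → Tight-mono u v) (λ v → tighten u v)) M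

module TightMetric {V : Set} {g : ℕ} {c : V → Bool} {D : SignedDistance V} (M : SignedMetric g c D)
                   (tight : ∀ u v → Tight g u v D) where
  open SignedMetric M

  -- The positive distance now determines the negative one, so realising `w` on the torus realises
  -- both.
  w : V → V → ℕ
  w u v = D u v false

  -- Tightness gives one inequality; the other is the triangle inequality on the way from u through
  -- v to the antipode of u.
  w-antipodal : ∀ u v → w u v + D u v true ≡ g
  w-antipodal u v = ≤-antisym (tight u v)
    (subst₂ _≤_ (antipodal u) (cong (D u v false +_) (symmetric v u true)) (triangle u v u false true))

  -- This is the triangle inequality from v through u to x along the negative distances g - w u v
  -- and g - w u x, whose signs cancel.
  w-perimeter : ∀ u v x → w u v + w u x + w v x ≤ g + g
  w-perimeter u v x = begin
    w u v + w u x + w v x                                 ≡⟨ lemma (w u v) (w u x) (w v x) ⟩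
    w v x + (w u v + w u x)                               ≤⟨ +-monoˡ-≤ (w u v + w u x) (triangle v u x true true) ⟩
    D v u true + D u x true + (w u v + w u x)             ≡⟨ cong (λ d → d + D u x true + (w u v + w u x)) (symmetric v u true) ⟩
    D u v true + D u x true + (w u v + w u x)             ≡⟨ lemma′ (D u v true) (D u x true) (w u v) (w u x) ⟩
    (w u v + D u v true) + (w u x + D u x true)           ≡⟨ cong₂ _+_ (w-antipodal u v) (w-antipodal u x) ⟩
    g + g                                                 ∎
    where
    open ≤-Reasoning
    lemma : ∀ p q r → p + q + r ≡ r + (p + q)
    lemma = solve-∀
    lemma′ : ∀ p q r s → p + q + (r + s) ≡ (r + p) + (s + q)
    lemma′ = solve-∀

  -- The perimeter is even because each of the three colours enters twice.
  w-tripod : ∀ x y v → Tripod (w x y) (w x v) (w y v) g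
  w-tripod x y v = tripod-of
    (subst (λ d → w x y ≤ w x v + d) (symmetric v y false) (triangle x v y false false))
    (triangle x y v false false)
    (subst (λ d → w y v ≤ d + w x v) (symmetric y x false) (triangle y x v false false))
    (w-perimeter x y v)
    (trans (odd-+ (w x y + w x v) (w y v)) (trans (cong₂ _xor_ (trans (odd-+ (w x y) (w x v)) (cong₂ _xor_ (parity x y false) (parity x v false))) (parity y v false))
      (lemma (c x) (c y) (c v))))
    where
    open xor-∧-Solver
    lemma : ∀ x y v → (((x xor y) xor false) xor ((x xor v) xor false)) xor ((y xor v) xor false) ≡ false
    lemma = solve 3 (λ x y v → (((x :+ y) :+ con false) :+ ((x :+ v) :+ con false)) :+ ((y :+ v) :+ con false) := con false) refl

-- Signed walks, parities and truncated distances

_++ʷ_ : ∀ {G u v w} → Walk G u v → Walk G v w → Walk G u w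
[]       ++ʷ W = W
(s ∷ W₁) ++ʷ W = s ∷ (W₁ ++ʷ W)

walkLength-++ : ∀ {G u v w} (W₁ : Walk G u v) (W₂ : Walk G v w) → walkLength (W₁ ++ʷ W₂) ≡ walkLength W₁ + walkLength W₂
walkLength-++ []       W₂ = refl
walkLength-++ (s ∷ W₁) W₂ = cong suc (walkLength-++ W₁ W₂)

walkSign-++ : ∀ {G u v w} (W₁ : Walk G u v) (W₂ : Walk G v w) → walkSign (W₁ ++ʷ W₂) ≡ walkSign W₁ xor walkSign W₂
walkSign-++ []       W₂ = refl
walkSign-++ {G} (s ∷ W₁) W₂ = trans (cong (sign G (stepEdge s) xor_) (walkSign-++ W₁ W₂)) (sym (xor-assoc (sign G (stepEdge s)) _ _))

-- The form in which the girth hypothesis enters: `closed-parity` excludes the two types of closed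
-- walk that TT(g) lacks, and `closed-length` is the bound on the remaining negative type.
record Admissible (g : ℕ) (G : SignedGraph) : Set where
  field
    closed-parity : ∀ {v} (W : Walk G v v) → odd (walkLength W) ≡ walkSign W ∧ odd g
    closed-length : ∀ {v} (W : Walk G v v) → walkSign W ≡ true → g ≤ walkLength W

module Colouring {G : SignedGraph} {g} (adm : Admissible g G) (conn : Connected G) (root : V G) where
  open Admissible adm

  -- The deviation of a walk from the parity rule for closed walks. It is additive and vanishes on
  -- closed walks, hence is the difference of a colouring `c` at the ends. For even g this is a
  -- proper 2-colouring; for odd g switching at it makes all edges negative.
  twist : ∀ {u v} → Walk G u v → Bool
  twist W = odd (walkLength W) xor (walkSign W ∧ odd g)

  twist-++ : ∀ {u v w} (W₁ : Walk G u v) (W₂ : Walk G v w) → twist (W₁ ++ʷ W₂) ≡ twist W₁ xor twist W₂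
  twist-++ W₁ W₂ = trans (cong₂ (λ l s → l xor (s ∧ odd g)) (trans (cong odd (walkLength-++ W₁ W₂)) (odd-+ (walkLength W₁) (walkLength W₂))) (walkSign-++ W₁ W₂))
    (solve 5 (λ l l′ s s′ g → (l :+ l′) :+ ((s :+ s′) :* g) := (l :+ (s :* g)) :+ (l′ :+ (s′ :* g))) refl
      (odd (walkLength W₁)) (odd (walkLength W₂)) (walkSign W₁) (walkSign W₂) (odd g))
    where open xor-∧-Solver

  twist-closed : ∀ {v} (W : Walk G v v) → twist W ≡ false
  twist-closed W = trans (cong (_xor (walkSign W ∧ odd g)) (closed-parity W)) (xor-same (walkSign W ∧ odd g))

  c : V G → Bool
  c v = twist (conn root v)

  twist-walk : ∀ {u v} (W : Walk G u v) → twist W ≡ c u xor c v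
  twist-walk {u} {v} W = lemma (c u) (twist W) (twist back) (c v) around there
    where
    back = conn v root
    around : c u xor (twist W xor twist back) ≡ false
    around = trans (sym (trans (twist-++ (conn root u) (W ++ʷ back)) (cong (c u xor_) (twist-++ W back))))
      (twist-closed (conn root u ++ʷ (W ++ʷ back)))
    there : c v xor twist back ≡ false
    there = trans (sym (twist-++ (conn root v) back)) (twist-closed (conn root v ++ʷ back))
    lemma : ∀ u w b v → u xor (w xor b) ≡ false → v xor b ≡ false → w ≡ u xor v
    lemma u w b v p q = trans (solve 4 (λ u w b v → w := (u :+ (w :+ b)) :+ ((v :+ b) :+ (u :+ v))) refl u w b v)
      (cong₂ (λ x y → x xor (y xor (u xor v))) p q)
      where open xor-∧-Solver

-- Only distances below g ∸ 1 need a walk.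
Witness : (G : SignedGraph) → ℕ → V G → V G → Bool → ℕ → Set
Witness G g u v s k = g ≤ suc k ⊎ Σ (Walk G u v) λ W → walkSign W ≡ s × walkLength W ≤ k

join-witness : ∀ {G g u x y v α β k l} (s : Step G x y) → Witness G g u x α k → Witness G g y v β l →
  Witness G g u v (α xor (sign G (stepEdge s) xor β)) (k + 1 + l)
join-witness {k = k} {l} s (inj₁ le) _ = inj₁ (≤-trans le (s≤s (≤-trans (m≤m+n k 1) (m≤m+n (k + 1) l))))
join-witness {k = k} {l} s (inj₂ _) (inj₁ le) = inj₁ (≤-trans le (s≤s (m≤n+m l (k + 1))))
join-witness s (inj₂ (W₁ , refl , length₁)) (inj₂ (W₂ , refl , length₂)) = inj₂ (W₁ ++ʷ (s ∷ W₂) , walkSign-++ W₁ (s ∷ W₂) ,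
  ≤-trans (≤-reflexive (trans (walkLength-++ W₁ (s ∷ W₂)) (sym (+-assoc (walkLength W₁) 1 (walkLength W₂)))))
    (+-mono-≤ (+-monoˡ-≤ 1 length₁) length₂))

module Distances {n m} (en : Fin m → Fin n × Fin n) (σ : Fin m → Bool) {g : ℕ} (2≤g : 2 ≤ g)
                 (adm : Admissible g (finSG n m en σ)) (conn : Connected (finSG n m en σ)) (root : Fin n) where
  open Admissible adm
  open Colouring adm conn root

  G : SignedGraph
  G = finSG n m en σ

  bit : Bool → ℕ
  bit false = 0
  bit true  = 1

  bit≤1 : ∀ b → bit b ≤ 1
  bit≤1 false = z≤n
  bit≤1 true  = s≤s z≤n

  odd-bit : ∀ b → odd (bit b) ≡ b
  odd-bit false = refl
  odd-bit true  = refl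

  class : Fin n → Fin n → Bool → Bool
  class u v s = (c u xor c v) xor (s ∧ odd g)

  -- Any two of these values add up to at least g, so the triangle inequality holds at the start.
  far : Fin n → Fin n → Bool → ℕ
  far u v s = g ∸ bit (odd g xor class u v s)

  g≤1+far : ∀ u v s → g ≤ suc (far u v s)
  g≤1+far u v s = ≤-trans (m≤n+m∸n g (bit b)) (+-monoˡ-≤ (far u v s) (bit≤1 b))
    where b = odd g xor class u v s

  far-parity : ∀ u v s → odd (far u v s) ≡ class u v s
  far-parity u v s = trans (odd-∸ (≤-trans (bit≤1 b) (≤-trans (n≤1+n 1) 2≤g)))
    (trans (cong (odd g xor_) (odd-bit b)) (solve 2 (λ g k → g :+ (g :+ k) := k) refl (odd g) (class u v s)))
    where
    open xor-∧-Solver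
    b = odd g xor class u v s

  far-symmetric : ∀ u v s → far u v s ≡ far v u s
  far-symmetric u v s = cong (λ b → g ∸ bit (odd g xor (b xor (s ∧ odd g)))) (xor-comm (c u) (c v))

  -- The signed metric of the graph without edges: off the diagonal, distances are as large as their
  -- parity and the bound g permit. Edges are then added one at a time, which avoids minima over all
  -- walks.
  initial : SignedDistance (Fin n)
  initial u v s with u ≟ v
  ... | no _  = far u v s
  ... | yes _ = if s then g else 0

  initial-≡ : ∀ u s → initial u u s ≡ (if s then g else 0)
  initial-≡ u s with u ≟ u
  ... | no u≢u = contradiction refl u≢u
  ... | yes _  = refl

  initial-≢ : ∀ {u v} s → u ≢ v → initial u v s ≡ far u v s
  initial-≢ {u} {v} s u≢v with u ≟ v
  ... | no _    = refl
  ... | yes u≡v = contradiction u≡v u≢v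

  initial-bounded : ∀ u v s → initial u v s ≤ g
  initial-bounded u v s with u ≟ v
  ... | no _ = m∸n≤m g (bit (odd g xor class u v s))
  initial-bounded u v false | yes _ = z≤n
  initial-bounded u v true  | yes _ = ≤-refl

  initial-symmetric : ∀ u v s → initial u v s ≡ initial v u s
  initial-symmetric u v s with u ≟ v
  ... | yes refl = sym (initial-≡ u s)
  ... | no u≢v   = trans (far-symmetric u v s) (sym (initial-≢ s (λ v≡u → u≢v (sym v≡u))))

  initial-parity : ∀ u v s → odd (initial u v s) ≡ class u v s
  initial-parity u v s with u ≟ v
  ... | no _ = far-parity u v s
  initial-parity u .u false | yes refl = sym (trans (xor-identityʳ _) (xor-same (c u)))
  initial-parity u .u true  | yes refl = sym (cong (_xor odd g) (xor-same (c u)))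

  initial-not : ∀ u v s → initial u v (not s) ≤ g + initial u v s
  initial-not u v s = ≤-trans (initial-bounded u v (not s)) (m≤m+n g _)

  initial-triangle : ∀ u v w s t → initial u w (s xor t) ≤ initial u v s + initial v w t
  initial-triangle u v w s t with u ≟ v
  initial-triangle u .u w false t | yes refl = ≤-refl
  initial-triangle u .u w true  t | yes refl = initial-not u w t
  initial-triangle u v w s t | no u≢v with v ≟ w
  ... | no v≢w = ≤-trans (initial-bounded u w (s xor t)) (s≤s⁻¹ (begin
    suc g                                ≤⟨ s≤s (g≤1+far u v s) ⟩
    2 + far u v s                        ≡⟨ +-comm 2 (far u v s) ⟩
    far u v s + 2                        ≤⟨ +-monoʳ-≤ (far u v s) (≤-trans 2≤g (g≤1+far v w t)) ⟩
    far u v s + suc (far v w t)          ≡⟨ +-suc (far u v s) (far v w t) ⟩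
    suc (far u v s + far v w t)          ∎))
    where open ≤-Reasoning
  initial-triangle u v .v s false | no u≢v | yes refl = ≤-reflexive (trans (cong (initial u v) (xor-identityʳ s))
    (trans (initial-≢ s u≢v) (sym (+-identityʳ _))))
  initial-triangle u v .v s true | no u≢v | yes refl = ≤-trans (initial-bounded u v (s xor true)) (m≤n+m g (far u v s))

  initial-metric : SignedMetric g c initial
  initial-metric = record
    { reflexive = λ u → initial-≡ u false
    ; antipodal = λ u → initial-≡ u true
    ; symmetric = initial-symmetric
    ; triangle  = initial-triangle
    ; parity    = initial-parity
    ; bounded   = initial-bounded
    }

  Witnessed : SignedDistance (Fin n) → Set
  Witnessed D = ∀ u v s → Witness G g u v s (D u v s)

  initial-witnessed : Witnessed initial
  initial-witnessed u v s with u ≟ v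
  ... | no _ = inj₁ (g≤1+far u v s)
  initial-witnessed u .u false | yes refl = inj₂ ([] , refl , z≤n)
  initial-witnessed u .u true  | yes refl = inj₁ (n≤1+n g)

  GoodMetric : SignedDistance (Fin n) → Set
  GoodMetric D = SignedMetric g c D × Witnessed D

  Short : Fin m → SignedDistance (Fin n) → Set
  Short e D = D (proj₁ (en e)) (proj₂ (en e)) (σ e) ≤ 1

  edge-class : ∀ e → true ≡ class (proj₁ (en e)) (proj₂ (en e)) (σ e)
  edge-class e = trans
    (solve 2 (λ s g → con true := (con true :+ ((s :+ con false) :* g)) :+ (s :* g)) refl (σ e) (odd g))
    (cong (_xor (σ e ∧ odd g)) (twist-walk (fwd e refl ∷ [])))
    where open xor-∧-Solver

  -- To add e with length 1, the opposite distance between its ends must be at least g - 1.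
  -- Otherwise that distance has a walk behind it, which e closes to a negative closed walk.
  shorten : ∀ e {D} → GoodMetric D → Improvement GoodMetric (Short e) D
  shorten e {D} (M , wit) = improvement relax-≼ (relax-metric , λ u v s → witness (route u v s)) relax-edge
    where
    open SignedMetric M
    x = proj₁ (en e)
    y = proj₂ (en e)
    large : g ≤ suc (D y x (not (σ e)))
    large with wit y x (not (σ e))
    ... | inj₁ le = le
    ... | inj₂ (W , W-sign , W-length) = ≤-trans
      (closed-length (fwd e refl ∷ W) (trans (cong (σ e xor_) W-sign) (xor-not-self (σ e)))) (s≤s W-length)
    open Relax M x y (σ e) 1 large (edge-class e)
    witness : ∀ {u v s k} → Route u v s k → Witness G g u v s k
    witness (direct refl) = wit _ _ _
    witness (via false α β refl refl) = join-witness (fwd e refl) (wit _ x α) (wit y _ β)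
    witness (via true  α β refl refl) = join-witness (bwd e refl) (wit _ y α) (wit x _ β)

  shorten-all : Improvement GoodMetric (λ D → ∀ e → Short e D) initial
  shorten-all = improve-all {Inv = GoodMetric} m {Short} (λ e D′≼D → ≤-trans (D′≼D (proj₁ (en e)) (proj₂ (en e)) (σ e))) shorten (initial-metric , initial-witnessed)

  -- The order matters: `shorten` relies on walks of G behind the small distances, while tightening
  -- brings in lengths that no walk of G has. Short edges stay short because tightening only
  -- decreases distances.
  tight-metric : ∃ λ D → SignedMetric g c D × (∀ u v → Tight g u v D) × (∀ e → Short e D)
  tight-metric = distance tightened , invariant tightened , done tightened ,
    λ e → ≤-trans (smaller tightened (proj₁ (en e)) (proj₂ (en e)) (σ e)) (done shorten-all e)
    where
    open Improvement
    tightened : Improvement (SignedMetric g c) (λ D → ∀ u v → Tight g u v D) (distance shorten-all)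
    tightened = tighten-all (proj₁ (invariant shorten-all))

  -- Parity keeps an edge from collapsing: its length is odd, so at most 1 means 1.
  short-edge : ∀ {D} → SignedMetric g c D → ∀ e → Short e D → D (proj₁ (en e)) (proj₂ (en e)) (σ e) ≡ 1
  short-edge M e short = odd≤1 short (trans (SignedMetric.parity M _ _ (σ e)) (sym (edge-class e)))
    where
    odd≤1 : ∀ {k} → k ≤ 1 → odd k ≡ true → k ≡ 1
    odd≤1 z≤n       ()
    odd≤1 (s≤s z≤n) _ = refl

-- Contractions and K4 minors

⊎-search : ∀ {n} {P Q : Fin n → Set} → (∀ i → P i ⊎ Q i) → (∀ i → P i) ⊎ ∃ Q
⊎-search {zero} _ = inj₁ λ ()
⊎-search {suc n} f with f zero | ⊎-search (f ∘ suc)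
... | inj₂ q | _            = inj₂ (zero , q)
... | inj₁ _ | inj₂ (i , q) = inj₂ (suc i , q)
... | inj₁ p | inj₁ ps      = inj₁ λ { zero → p ; (suc i) → ps i }

-- Distinct elements are picked one by one and excluded from the predicate, so explicit neighbours
-- can be listed and carried along injections without cardinalities.
AtLeast : ∀ {n} → ℕ → (Fin n → Set) → Set
AtLeast zero    P = ⊤
AtLeast (suc k) P = ∃ λ a → P a × AtLeast k (λ x → P x × x ≢ a)

AtLeast-image : ∀ {n} k {P Q : Fin n → Set} (f : Fin n → Fin n) → (∀ {x} → P x → Q (f x)) →
  (∀ {x y} → P x → P y → f x ≡ f y → x ≡ y) → AtLeast k P → AtLeast k Q
AtLeast-image zero    f imp inj _ = _
AtLeast-image (suc k) f imp inj (a , pa , rest) = f a , imp pa ,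
  AtLeast-image k f (λ (px , x≢a) → imp px , λ fx≡fa → x≢a (inj px pa fx≡fa)) (λ (px , _) (py , _) → inj px py) rest

AtLeast-map : ∀ {n} k {P Q : Fin n → Set} → (∀ {x} → P x → Q x) → AtLeast k P → AtLeast k Q
AtLeast-map k imp = AtLeast-image k id imp (λ _ _ eq → eq)

AtLeast-drop : ∀ {n} k {P : Fin n → Set} → AtLeast (suc k) P → ∀ p → AtLeast k (λ x → P x × x ≢ p)
AtLeast-drop zero    _ p = _
AtLeast-drop (suc k) (a , pa , rest) p with a ≟ p
... | yes refl = rest
... | no a≢p   = a , (pa , a≢p) ,
  AtLeast-map k (λ ((px , x≢a) , x≢p) → (px , x≢p) , x≢a) (AtLeast-drop k rest p)

contract : ∀ {n} → Fin n → Fin n → Fin n → Fin n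
contract p q z with z ≟ p
... | yes _ = q
... | no _  = z

contract-≡ : ∀ {n} (p q : Fin n) → contract p q p ≡ q
contract-≡ p q with p ≟ p
... | yes _  = refl
... | no p≢p = contradiction refl p≢p

contract-≢ : ∀ {n} {p z : Fin n} q → z ≢ p → contract p q z ≡ z
contract-≢ {p = p} {z} q z≢p with z ≟ p
... | yes z≡p = contradiction z≡p z≢p
... | no _    = refl

contract-≢p : ∀ {n} {p q : Fin n} z → p ≢ q → contract p q z ≢ p
contract-≢p {p = p} z p≢q with z ≟ p
... | yes _   = λ q≡p → p≢q (sym q≡p)
... | no z≢p  = z≢p

contract-fibre : ∀ {n} {p q x y : Fin n} → contract p q x ≡ contract p q y → x ≢ y → (x ≡ p × y ≡ q) ⊎ (y ≡ p × x ≡ q)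
contract-fibre {p = p} {q} {x} {y} eq x≢y with x ≟ p | y ≟ p
... | yes x≡p | yes y≡p = contradiction (trans x≡p (sym y≡p)) x≢y
... | yes x≡p | no _    = inj₁ (x≡p , sym eq)
... | no _    | yes y≡p = inj₂ (y≡p , eq)
... | no _    | no _    = contradiction eq x≢y

module _ {G : SignedGraph} where
  WalkIn-map : ∀ {P Q : V G → Set} {u v} → (∀ {w} → P w → Q w) → WalkIn G P u v → WalkIn G Q u v
  WalkIn-map imp (here p)     = here (imp p)
  WalkIn-map imp (step p s W) = step (imp p) s (WalkIn-map imp W)

  WalkIn-step : ∀ {P : V G → Set} {u v w x} → WalkIn G P u v → Step G v w → WalkIn G P w x → WalkIn G P u x
  WalkIn-step (here p)      t W₂ = step p t W₂
  WalkIn-step (step p s W₁) t W₂ = step p s (WalkIn-step W₁ t W₂)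

-- A map ρ on the vertices stands for the graph obtained from G by contracting each fibre of ρ to its value.
module Contraction {n m} (en : Fin m → Fin n × Fin n) (σ : Fin m → Bool) where

  G : SignedGraph
  G = finSG n m en σ

  Joins : (Fin n → Fin n) → Fin n → Fin n → Fin m → Set
  Joins ρ x y e = (ρ (proj₁ (en e)) ≡ x × ρ (proj₂ (en e)) ≡ y) ⊎ (ρ (proj₁ (en e)) ≡ y × ρ (proj₂ (en e)) ≡ x)

  record Adj (ρ : Fin n → Fin n) (x y : Fin n) : Set where
    constructor adjacent
    field
      distinct : x ≢ y
      edge     : ∃ (Joins ρ x y)
  open Adj

  adj? : ∀ ρ x y → Dec (Adj ρ x y)
  adj? ρ x y = map′ (λ (ne , j) → adjacent ne j) (λ a → distinct a , edge a) (¬? (x ≟ y) ×-dec any? λ e →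
    ((ρ (proj₁ (en e)) ≟ x) ×-dec (ρ (proj₂ (en e)) ≟ y)) ⊎-dec ((ρ (proj₁ (en e)) ≟ y) ×-dec (ρ (proj₂ (en e)) ≟ x)))

  adj-sym : ∀ {ρ x y} → Adj ρ x y → Adj ρ y x
  adj-sym (adjacent x≢y (e , inj₁ j)) = adjacent (≢-sym x≢y) (e , inj₂ j)
  adj-sym (adjacent x≢y (e , inj₂ j)) = adjacent (≢-sym x≢y) (e , inj₁ j)

  adj-edge : ∀ {ρ x y} → Adj ρ x y → ∃ λ u → ∃ λ w → ρ u ≡ x × ρ w ≡ y × Step G u w
  adj-edge (adjacent _ (e , inj₁ (eq , eq′))) = _ , _ , eq , eq′ , fwd e refl
  adj-edge (adjacent _ (e , inj₂ (eq , eq′))) = _ , _ , eq′ , eq , bwd e refl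

  edge-adj : ∀ {ρ u w} → Step G u w → ρ u ≢ ρ w → Adj ρ (ρ u) (ρ w)
  edge-adj (fwd e refl) ne = adjacent ne (e , inj₁ (refl , refl))
  edge-adj (bwd e refl) ne = adjacent ne (e , inj₂ (refl , refl))

  adj-map : ∀ {ρ x y x′ y′} (κ : Fin n → Fin n) → Adj ρ x y → κ x ≡ x′ → κ y ≡ y′ → x′ ≢ y′ → Adj (κ ∘ ρ) x′ y′
  adj-map κ adj refl refl ne with adj-edge adj
  ... | _ , _ , refl , refl , s = edge-adj s ne

  -- The fibres are connected in G, as branch sets of a minor have to be.
  Connects : (Fin n → Fin n) → Set
  Connects ρ = ∀ r u v → ρ u ≡ r → ρ v ≡ r → WalkIn G (λ w → ρ w ≡ r) u v

  connects-id : Connects id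
  connects-id r .r .r refl refl = here refl

  connects-contract : ∀ {ρ p q} → Adj ρ p q → Connects ρ → Connects (contract p q ∘ ρ)
  connects-contract {ρ} {p} {q} adj conn r u v eu ev with ρ u ≟ ρ v
  ... | yes eq = WalkIn-map (λ e → trans (cong (contract p q) (trans e (sym eq))) eu) (conn (ρ v) u v eq refl)
  ... | no ne with adj-edge adj | contract-fibre (trans eu (sym ev)) ne
  ...   | x , y , ex , ey , s | inj₁ (up , vq) = WalkIn-step
    (WalkIn-map (λ e → trans (cong (contract p q) (trans e (sym up))) eu) (conn p u x up ex)) s
    (WalkIn-map (λ e → trans (cong (contract p q) (trans e (sym vq))) ev) (conn q y v ey vq))
  ...   | x , y , ex , ey , s | inj₂ (vp , uq) = WalkIn-step
    (WalkIn-map (λ e → trans (cong (contract p q) (trans e (sym uq))) eu) (conn q u y uq ey)) (back s)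
    (WalkIn-map (λ e → trans (cong (contract p q) (trans e (sym vp))) ev) (conn p x v ex vp))
    where
    back : ∀ {x y} → Step G x y → Step G y x
    back (fwd e eq) = bwd e eq
    back (bwd e eq) = fwd e eq

  -- The termination measure is the size of any set that contains the values of ρ, so the image
  -- itself is never computed.
  Shrinks : (Fin n → Fin n) → (Fin n → Fin n) → Set
  Shrinks ρ ρ′ = ∀ S → (∀ u → ρ u ∈ S) → ∃ λ S′ → card S′ < card S × (∀ u → ρ′ u ∈ S′)

  shrinks-trans : ∀ {ρ ρ′ ρ″} → Shrinks ρ ρ′ → Shrinks ρ′ ρ″ → Shrinks ρ ρ″
  shrinks-trans sh sh′ S in-S with sh S in-S
  ... | S′ , lt , in-S′ with sh′ S′ in-S′
  ...   | S″ , lt′ , in-S″ = S″ , <-trans lt′ lt , in-S″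

  shrinks-contract : ∀ {ρ p q} → Adj ρ p q → Shrinks ρ (contract p q ∘ ρ)
  shrinks-contract {ρ} {p} {q} adj S in-S with adj-edge adj
  ... | x , y , refl , refl , _ = S ∖ p , x∈p⇒∣p-x∣<∣p∣ (in-S x) , λ u → x∈p∧x≢y⇒x∈p-y (stays (ρ u) (in-S u)) (contract-≢p (ρ u) (distinct adj))
    where
    stays : ∀ z → z ∈ S → contract p q z ∈ S
    stays z z∈S with z ≟ p
    ... | yes _ = in-S y
    ... | no _  = z∈S

  MinDegree : (Fin n → Fin n) → Set
  MinDegree ρ = ∀ u → AtLeast 3 (Adj ρ (ρ u))

  Smaller : (Fin n → Fin n) → Set
  Smaller ρ = ∃ λ ρ′ → Connects ρ′ × MinDegree ρ′ × Shrinks ρ ρ′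

  -- A graph of minimum degree 3 is K4 or has a contraction of minimum degree 3: if all degrees are at
  -- least 4, contract any edge; otherwise let v have exactly the neighbours a, b, c.  An edge at a
  -- vertex of degree 3 in no triangle can be contracted, so assume a ~ b ~ c and not a ~ c.  If b has
  -- degree at least 4, contract va.  Otherwise the third edge at a or c is in no triangle if that vertex
  -- has degree 3, and if both have degree at least 4, contract va and bc.
  module Reduction (ρ : Fin n → Fin n) (conn : Connects ρ) (deg : MinDegree ρ) where

    _~_ : Fin n → Fin n → Set
    _~_ = Adj ρ

    degree : ∀ {x y} → x ~ y → AtLeast 3 (x ~_)
    degree adj with adj-edge adj
    ... | u , _ , refl , _ = deg u

    fresh : ∀ {x y} → x ~ y → ∀ p q → ∃ λ z → x ~ z × z ≢ p × z ≢ q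
    fresh adj p q with AtLeast-drop 1 (AtLeast-drop 2 (degree adj) p) q
    ... | z , ((xz , z≢p) , z≢q) , _ = z , xz , z≢p , z≢q

    smaller : ∀ {p q} → p ~ q → AtLeast 3 (Adj (contract p q ∘ ρ) q) →
      (∀ u → ρ u ≢ p → ρ u ≢ q → AtLeast 3 (Adj (contract p q ∘ ρ) (ρ u))) → Smaller ρ
    smaller {p} {q} pq deg-q deg-z = contract p q ∘ ρ , connects-contract pq conn , deg′ , shrinks-contract pq
      where
      deg′ : MinDegree (contract p q ∘ ρ)
      deg′ u with ρ u ≟ p | ρ u ≟ q
      ... | yes _ | _      = deg-q
      ... | no _ | yes eq = subst (λ z → AtLeast 3 (Adj (contract p q ∘ ρ) z)) (sym eq) deg-q
      ... | no ≢p | no ≢q  = deg-z u ≢p ≢q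

    keep-away : ∀ k {p q z} → z ≢ p → AtLeast k (λ x → z ~ x × x ≢ p) → AtLeast k (Adj (contract p q ∘ ρ) z)
    keep-away k {p} {q} z≢p = AtLeast-map k λ (zx , x≢p) →
      adj-map (contract p q) zx (contract-≢ q z≢p) (contract-≢ q x≢p) (distinct zx)

    -- The contraction identifies p and q only, so a vertex that is not adjacent to both keeps its
    -- neighbours distinct.
    keep : ∀ {p q z} → p ≢ q → z ≢ p → z ≢ q → ¬ (z ~ p × z ~ q) → AtLeast 3 (z ~_) → AtLeast 3 (Adj (contract p q ∘ ρ) z)
    keep {p} {q} {z} p≢q z≢p z≢q ¬common three with adj? ρ z p
    ... | no ¬zp = keep-away 3 z≢p (AtLeast-map 3 (λ zx → zx , λ { refl → ¬zp zx }) three)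
    ... | yes zp = AtLeast-image 3 (contract p q) image injective three
      where
      ≢q : ∀ {x} → z ~ x → x ≢ q
      ≢q zx refl = ¬common (zp , zx)
      image : ∀ {x} → z ~ x → Adj (contract p q ∘ ρ) z (contract p q x)
      image {x} zx = adj-map (contract p q) zx (contract-≢ q z≢p) refl z≢κx
        where
        z≢κx : z ≢ contract p q x
        z≢κx eq with x ≟ p
        ... | yes _ = z≢q eq
        ... | no _  = distinct zx eq
      injective : ∀ {x y} → z ~ x → z ~ y → contract p q x ≡ contract p q y → x ≡ y
      injective {x} {y} zx zy eq with x ≟ y
      ... | yes x≡y = x≡y
      ... | no x≢y with contract-fibre eq x≢y
      ...   | inj₁ (_ , y≡q) = contradiction y≡q (≢q zy)
      ...   | inj₂ (_ , x≡q) = contradiction x≡q (≢q zx)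

    -- Two neighbours of q other than p remain, and y is a new third one, inherited from p.
    merge : ∀ {p q y} → p ~ q → p ~ y → y ≢ q → ¬ (q ~ y) → AtLeast 3 (Adj (contract p q ∘ ρ) q)
    merge {p} {q} {y} pq py y≢q ¬qy = y ,
      adj-map (contract p q) py (contract-≡ p q) (contract-≢ q (≢-sym (distinct py))) (≢-sym y≢q) ,
      AtLeast-map 2 (λ (qx , x≢p) → adj-map (contract p q) qx (contract-≢ q (≢-sym (distinct pq))) (contract-≢ q x≢p) (distinct qx) ,
                       λ { refl → ¬qy qx })
        (AtLeast-drop 2 (degree (adj-sym pq)) p)

    contract-edge : ∀ {p q} → p ~ q → (∀ z → ¬ (z ~ p × z ~ q)) → Smaller ρ
    contract-edge {p} {q} pq ¬common with fresh pq q q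
    ... | y , py , y≢q , _ = smaller pq (merge pq py y≢q (λ qy → ¬common y (adj-sym py , adj-sym qy)))
      (λ u ≢p ≢q → keep (distinct pq) ≢p ≢q (¬common (ρ u)) (deg u))

    Exact : Fin n → Fin n → Fin n → Fin n → Set
    Exact v a b c = ∀ z → v ~ z → z ≡ a ⊎ z ≡ b ⊎ z ≡ c

    fourth? : ∀ v a b c → (∃ λ d → v ~ d × d ≢ a × d ≢ b × d ≢ c) ⊎ Exact v a b c
    fourth? v a b c with any? (λ d → adj? ρ v d ×-dec ¬? (d ≟ a) ×-dec ¬? (d ≟ b) ×-dec ¬? (d ≟ c))
    ... | yes d = inj₁ d
    ... | no ¬d = inj₂ exact
      where
      exact : Exact v a b c
      exact z vz with z ≟ a | z ≟ b | z ≟ c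
      ... | yes p | _ | _ = inj₁ p
      ... | no _ | yes p | _ = inj₂ (inj₁ p)
      ... | no _ | no _ | yes p = inj₂ (inj₂ p)
      ... | no p | no q | no r = contradiction (z , vz , p , q , r) ¬d

    record Cubic (v a b c : Fin n) : Set where
      field
        va : v ~ a
        vb : v ~ b
        vc : v ~ c
        b≢a : b ≢ a
        c≢a : c ≢ a
        c≢b : c ≢ b
        exact : Exact v a b c

    swap₁₂ : ∀ {v a b c} → Cubic v a b c → Cubic v b a c
    swap₁₂ q = record { va = vb ; vb = va ; vc = vc ; b≢a = ≢-sym b≢a ; c≢a = c≢b ; c≢b = c≢a
                      ; exact = λ z vz → [ inj₂ ∘ inj₁ , [ inj₁ , inj₂ ∘ inj₂ ]′ ]′ (exact z vz) }
      where open Cubic q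

    swap₂₃ : ∀ {v a b c} → Cubic v a b c → Cubic v a c b
    swap₂₃ q = record { va = va ; vb = vc ; vc = vb ; b≢a = c≢a ; c≢a = b≢a ; c≢b = ≢-sym c≢b
                      ; exact = λ z vz → [ inj₁ , [ inj₂ ∘ inj₂ , inj₂ ∘ inj₁ ]′ ]′ (exact z vz) }
      where open Cubic q

    -- A vertex that remains loses at most the contracted vertex from its neighbours, so degree 4
    -- drops to no less than 3.
    contract-dense : Fin n → (∀ u → AtLeast 4 (Adj ρ (ρ u))) → Smaller ρ
    contract-dense u₀ dense with dense u₀
    ... | a , va , _ with adj-edge va
    ...   | _ , w , _ , refl , _ = smaller va
      (keep-away 3 (≢-sym (distinct va)) (AtLeast-drop 3 (dense w) (ρ u₀)))
      (λ u ≢p _ → keep-away 3 ≢p (AtLeast-drop 3 (dense u) (ρ u₀)))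

    contract-spoke : ∀ {v a b c} → Cubic v a b c → ¬ (a ~ b) → ¬ (a ~ c) → Smaller ρ
    contract-spoke {v} {a} q ¬ab ¬ac = contract-edge va no-common
      where
      open Cubic q
      no-common : ∀ z → ¬ (z ~ v × z ~ a)
      no-common z (zv , za) with exact z (adj-sym zv)
      ... | inj₁ refl        = distinct za refl
      ... | inj₂ (inj₁ refl) = ¬ab (adj-sym za)
      ... | inj₂ (inj₂ refl) = ¬ac (adj-sym za)

    -- The only common neighbour of v and a is b, which loses v but still has a, c and d. The merged
    -- vertex gains c.
    contract-fan : ∀ {v a b c d} → Cubic v a b c → a ~ b → b ~ c → ¬ (a ~ c) →
      b ~ d → d ≢ v → d ≢ a → d ≢ c → Smaller ρ
    contract-fan {v} {a} {b} {c} {d} q ab bc ¬ac bd d≢v d≢a d≢c =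
      smaller va (merge va vc c≢a ¬ac) others
      where
      open Cubic q
      deg-b : AtLeast 3 (Adj (contract v a ∘ ρ) b)
      deg-b = keep-away 3 (≢-sym (distinct vb))
        (a , (adj-sym ab , ≢-sym (distinct va)) , c , ((bc , ≢-sym (distinct vc)) , c≢a) , d , (((bd , d≢v) , d≢a) , d≢c) , _)
      others : ∀ u → ρ u ≢ v → ρ u ≢ a → AtLeast 3 (Adj (contract v a ∘ ρ) (ρ u))
      others u ≢v ≢a with ρ u ≟ b
      ... | yes eq = subst (λ z → AtLeast 3 (Adj (contract v a ∘ ρ) z)) (sym eq) deg-b
      ... | no ≢b = keep (distinct va) ≢v ≢a no-common (deg u)
        where
        no-common : ¬ (ρ u ~ v × ρ u ~ a)
        no-common (uv , ua) with exact (ρ u) (adj-sym uv)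
        ... | inj₁ eq        = ≢a eq
        ... | inj₂ (inj₁ eq) = ≢b eq
        ... | inj₂ (inj₂ eq) = ¬ac (adj-sym (subst (_~ a) eq ua))

    -- A common neighbour of a and a′ could only be v or b. Their neighbourhoods are known, and
    -- either case would leave a′ = c, contrary to a ≁ c.
    contract-tip : ∀ {v a b c a′} → Cubic v a b c → Exact b v a c → ¬ (a ~ c) →
      a ~ a′ → a′ ≢ v → a′ ≢ b → Exact a v b a′ → Smaller ρ
    contract-tip {v} {a} {b} {c} {a′} q exact-b ¬ac aa′ a′≢v a′≢b exact-a = contract-edge aa′ no-common
      where
      open Cubic q
      no-common : ∀ z → ¬ (z ~ a × z ~ a′)
      no-common z (za , za′) with exact-a z (adj-sym za)
      ... | inj₂ (inj₂ refl) = distinct za′ refl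
      ... | inj₁ refl with exact a′ za′
      ...   | inj₁ refl        = distinct aa′ refl
      ...   | inj₂ (inj₁ refl) = a′≢b refl
      ...   | inj₂ (inj₂ refl) = ¬ac aa′
      no-common z (za , za′) | inj₂ (inj₁ refl) with exact-b a′ za′
      ...   | inj₁ refl        = a′≢v refl
      ...   | inj₂ (inj₁ refl) = distinct aa′ refl
      ...   | inj₂ (inj₂ refl) = ¬ac aa′

    -- The neighbours of v and b all lie in the diamond, so no outside vertex is affected. The
    -- contraction makes a and c adjacent, and each keeps two further neighbours, distinct from the
    -- other because a ≁ c.
    contract-diamond : ∀ {v a b c a′ a″ c′ c″} → Cubic v a b c → Exact b v a c → a ~ b → b ~ c → ¬ (a ~ c) →
      a ~ a′ → a′ ≢ v → a′ ≢ b → a ~ a″ → a″ ≢ v → a″ ≢ b → a″ ≢ a′ →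
      c ~ c′ → c′ ≢ v → c′ ≢ b → c ~ c″ → c″ ≢ v → c″ ≢ b → c″ ≢ c′ → Smaller ρ
    contract-diamond {v} {a} {b} {c} {a′} {a″} {c′} {c″} q exact-b ab bc ¬ac aa′ a′≢v a′≢b aa″ a″≢v a″≢b a″≢a′ cc′ c′≢v c′≢b cc″ c″≢v c″≢b c″≢c′ =
      κ ∘ ρ , connects-contract bc₁ (connects-contract va conn) , deg′ ,
      shrinks-trans (shrinks-contract va) (shrinks-contract bc₁)
      where
      open Cubic q
      κ : Fin n → Fin n
      κ = contract b c ∘ contract v a
      a≢b : a ≢ b
      a≢b = ≢-sym b≢a
      bc₁ : Adj (contract v a ∘ ρ) b c
      bc₁ = adj-map (contract v a) bc (contract-≢ a (≢-sym (distinct vb))) (contract-≢ a (≢-sym (distinct vc))) (distinct bc)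
      κ-fix : ∀ {z} → z ≢ v → z ≢ b → κ z ≡ z
      κ-fix z≢v z≢b = trans (cong (contract b c) (contract-≢ a z≢v)) (contract-≢ c z≢b)
      κv : κ v ≡ a
      κv = trans (cong (contract b c) (contract-≡ v a)) (contract-≢ c a≢b)
      κb : κ b ≡ c
      κb = trans (cong (contract b c) (contract-≢ a (≢-sym (distinct vb)))) (contract-≡ b c)
      κa : κ a ≡ a
      κa = κ-fix (≢-sym (distinct va)) a≢b
      κc : κ c ≡ c
      κc = κ-fix (≢-sym (distinct vc)) c≢b
      ≢c : ∀ {x} → a ~ x → x ≢ c
      ≢c ax refl = ¬ac ax
      ≢a : ∀ {x} → c ~ x → x ≢ a
      ≢a cx refl = ¬ac (adj-sym cx)
      deg-a : AtLeast 3 (Adj (κ ∘ ρ) a)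
      deg-a = c , adj-map κ vc κv κc (≢-sym c≢a) ,
              a′ , (adj-map κ aa′ κa (κ-fix a′≢v a′≢b) (distinct aa′) , ≢c aa′) ,
              a″ , ((adj-map κ aa″ κa (κ-fix a″≢v a″≢b) (distinct aa″) , ≢c aa″) , a″≢a′) , _
      deg-c : AtLeast 3 (Adj (κ ∘ ρ) c)
      deg-c = a , adj-map κ (adj-sym ab) κb κa c≢a ,
              c′ , (adj-map κ cc′ κc (κ-fix c′≢v c′≢b) (distinct cc′) , ≢a cc′) ,
              c″ , ((adj-map κ cc″ κc (κ-fix c″≢v c″≢b) (distinct cc″) , ≢a cc″) , c″≢c′) , _
      Goal : Fin n → Set
      Goal z = AtLeast 3 (Adj (κ ∘ ρ) z)
      deg′ : MinDegree (κ ∘ ρ)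
      deg′ u = go (ρ u ≟ v) (ρ u ≟ a) (ρ u ≟ b) (ρ u ≟ c)
        where
        go : Dec (ρ u ≡ v) → Dec (ρ u ≡ a) → Dec (ρ u ≡ b) → Dec (ρ u ≡ c) → Goal (κ (ρ u))
        go (yes eq) _ _ _ = subst Goal (sym (trans (cong κ eq) κv)) deg-a
        go _ (yes eq) _ _ = subst Goal (sym (trans (cong κ eq) κa)) deg-a
        go _ _ (yes eq) _ = subst Goal (sym (trans (cong κ eq) κb)) deg-c
        go _ _ _ (yes eq) = subst Goal (sym (trans (cong κ eq) κc)) deg-c
        go (no ≢v) (no ≢a′) (no ≢b) (no ≢c′) = subst Goal (sym (κ-fix ≢v ≢b))
          (AtLeast-map 3 (λ {x} ux → adj-map κ ux (κ-fix ≢v ≢b) (κ-fix (≢v′ ux) (≢b′ ux)) (distinct ux)) (deg u))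
          where
          ≢v′ : ∀ {x} → ρ u ~ x → x ≢ v
          ≢v′ ux refl = [ ≢a′ , [ ≢b , ≢c′ ]′ ]′ (exact (ρ u) (adj-sym ux))
          ≢b′ : ∀ {x} → ρ u ~ x → x ≢ b
          ≢b′ ux refl = [ ≢v , [ ≢a′ , ≢c′ ]′ ]′ (exact-b (ρ u) (adj-sym ux))

    reduce-path : ∀ {v a b c} → Cubic v a b c → a ~ b → b ~ c → ¬ (a ~ c) → Smaller ρ
    reduce-path {v} {a} {b} {c} q ab bc ¬ac with fourth? b v a c
    ... | inj₁ (d , bd , d≢v , d≢a , d≢c) = contract-fan q ab bc ¬ac bd d≢v d≢a d≢c
    ... | inj₂ exact-b with fresh ab v b | fresh (adj-sym bc) v b
    ...   | a′ , aa′ , a′≢v , a′≢b | c′ , cc′ , c′≢v , c′≢b with fourth? a v b a′ | fourth? c v b c′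
    ...     | inj₂ exact-a | _ = contract-tip q exact-b ¬ac aa′ a′≢v a′≢b exact-a
    ...     | _ | inj₂ exact-c = contract-tip (swap₁₂ (swap₂₃ (swap₁₂ q)))
      (λ z bz → [ inj₁ , [ inj₂ ∘ inj₂ , inj₂ ∘ inj₁ ]′ ]′ (exact-b z bz)) (λ ca → ¬ac (adj-sym ca)) cc′ c′≢v c′≢b exact-c
    ...     | inj₁ (a″ , aa″ , a″≢v , a″≢b , a″≢a′) | inj₁ (c″ , cc″ , c″≢v , c″≢b , c″≢c′) =
      contract-diamond q exact-b ab bc ¬ac aa′ a′≢v a′≢b aa″ a″≢v a″≢b a″≢a′ cc′ c′≢v c′≢b cc″ c″≢v c″≢b c″≢c′

    complete-minor : (x : Fin 4 → Fin n) → (∀ i j → i ≢ j → x i ~ x j) → HasK4Minor G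
    complete-minor x adj = β , nonempty , connected , λ i j i≢j → proj₁ (edge (adj i j i≢j)) , joined i j (edge (adj i j i≢j))
      where
      β : Fin n → Maybe (Fin 4)
      β w with any? (λ i → x i ≟ ρ w)
      ... | yes (i , _) = just i
      ... | no _        = nothing
      β-sound : ∀ w i → β w ≡ just i → x i ≡ ρ w
      β-sound w i eq with any? (λ i → x i ≟ ρ w)
      β-sound w i refl | yes (.i , e) = e
      β-complete : ∀ w i → x i ≡ ρ w → β w ≡ just i
      β-complete w i eq with any? (λ i → x i ≟ ρ w)
      ... | no ¬i = contradiction (i , eq) ¬i
      ... | yes (j , eq′) with j ≟ i
      ...   | yes refl = refl
      ...   | no j≢i   = contradiction (trans eq′ (sym eq)) (distinct (adj j i j≢i))
      other : (i : Fin 4) → ∃ λ j → i ≢ j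
      other zero    = suc zero , λ ()
      other (suc i) = zero , λ ()
      nonempty : ∀ i → ∃ λ w → β w ≡ just i
      nonempty i with other i
      ... | j , i≢j with adj-edge (adj i j i≢j)
      ...   | u , _ , eq , _ = u , β-complete u i (sym eq)
      connected : ∀ i u v → β u ≡ just i → β v ≡ just i → WalkIn G (λ w → β w ≡ just i) u v
      connected i u v eu ev = WalkIn-map (λ {w} e → β-complete w i (sym e))
        (conn (x i) u v (sym (β-sound u i eu)) (sym (β-sound v i ev)))
      joined : ∀ i j (e : ∃ (Joins ρ (x i) (x j))) →
        (β (proj₁ (en (proj₁ e))) ≡ just i × β (proj₂ (en (proj₁ e))) ≡ just j) ⊎
        (β (proj₁ (en (proj₁ e))) ≡ just j × β (proj₂ (en (proj₁ e))) ≡ just i)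
      joined i j (e , inj₁ (p , q)) = inj₁ (β-complete _ i (sym p) , β-complete _ j (sym q))
      joined i j (e , inj₂ (p , q)) = inj₂ (β-complete _ j (sym p) , β-complete _ i (sym q))

    complete : ∀ {v a b c} → Cubic v a b c → a ~ b → b ~ c → a ~ c → HasK4Minor G
    complete {v} {a} {b} {c} q ab bc ac = complete-minor x adj
      where
      open Cubic q
      x : Fin 4 → Fin n
      x zero                   = v
      x (suc zero)             = a
      x (suc (suc zero))       = b
      x (suc (suc (suc zero))) = c
      adj : ∀ i j → i ≢ j → x i ~ x j
      adj zero zero ne = contradiction refl ne
      adj zero (suc zero) _ = va
      adj zero (suc (suc zero)) _ = vb
      adj zero (suc (suc (suc zero))) _ = vc
      adj (suc zero) zero _ = adj-sym va
      adj (suc zero) (suc zero) ne = contradiction refl ne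
      adj (suc zero) (suc (suc zero)) _ = ab
      adj (suc zero) (suc (suc (suc zero))) _ = ac
      adj (suc (suc zero)) zero _ = adj-sym vb
      adj (suc (suc zero)) (suc zero) _ = adj-sym ab
      adj (suc (suc zero)) (suc (suc zero)) ne = contradiction refl ne
      adj (suc (suc zero)) (suc (suc (suc zero))) _ = bc
      adj (suc (suc (suc zero))) zero _ = adj-sym vc
      adj (suc (suc (suc zero))) (suc zero) _ = adj-sym ac
      adj (suc (suc (suc zero))) (suc (suc zero)) _ = adj-sym bc
      adj (suc (suc (suc zero))) (suc (suc (suc zero))) ne = contradiction refl ne

    dense-or-cubic : ∀ u → AtLeast 4 (Adj ρ (ρ u)) ⊎ (∃ λ a → ∃ λ b → ∃ λ c → Cubic (ρ u) a b c)
    dense-or-cubic u with deg u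
    ... | a , va , b , (vb , b≢a) , c , ((vc , c≢a) , c≢b) , _ with fourth? (ρ u) a b c
    ...   | inj₁ (d , vd , d≢a , d≢b , d≢c) = inj₁
      (a , va , b , (vb , b≢a) , c , ((vc , c≢a) , c≢b) , d , (((vd , d≢a) , d≢b) , d≢c) , _)
    ...   | inj₂ exact = inj₂ (a , b , c , record
      { va = va ; vb = vb ; vc = vc ; b≢a = b≢a ; c≢a = c≢a ; c≢b = c≢b ; exact = exact })

    -- Three edges among a, b, c give K4, two form a path, and with fewer some neighbour of v is
    -- adjacent to neither of the others. The swaps bring each case into its standard form.
    reduce : Fin n → HasK4Minor G ⊎ Smaller ρ
    reduce u₀ with ⊎-search dense-or-cubic
    ... | inj₁ dense = inj₂ (contract-dense u₀ dense)
    ... | inj₂ (u , a , b , c , q) with adj? ρ a b | adj? ρ b c | adj? ρ a c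
    ...   | yes ab | yes bc | yes ac = inj₁ (complete q ab bc ac)
    ...   | no ¬ab | _      | no ¬ac = inj₂ (contract-spoke q ¬ab ¬ac)
    ...   | no ¬ab | no ¬bc | _      = inj₂ (contract-spoke (swap₁₂ q) (λ ba → ¬ab (adj-sym ba)) ¬bc)
    ...   | _      | no ¬bc | no ¬ac = inj₂ (contract-spoke (swap₁₂ (swap₂₃ q)) (λ ca → ¬ac (adj-sym ca)) (λ cb → ¬bc (adj-sym cb)))
    ...   | yes ab | yes bc | no ¬ac = inj₂ (reduce-path q ab bc ¬ac)
    ...   | yes ab | no ¬bc | yes ac = inj₂ (reduce-path (swap₁₂ q) (adj-sym ab) ac ¬bc)
    ...   | no ¬ab | yes bc | yes ac = inj₂ (reduce-path (swap₂₃ q) ac (adj-sym bc) ¬ab)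

  min-degree-minor : ∀ k {ρ} S → card S ≤ k → (∀ u → ρ u ∈ S) → Connects ρ → MinDegree ρ → Fin n → HasK4Minor G
  min-degree-minor k {ρ} S S≤k in-S conn deg u with Reduction.reduce ρ conn deg u
  ... | inj₁ minor = minor
  ... | inj₂ (ρ′ , conn′ , deg′ , shrinks) with shrinks S in-S
  min-degree-minor zero S S≤k _ _ _ _ | inj₂ _ | _ , lt , _ = contradiction (<-≤-trans lt S≤k) λ ()
  min-degree-minor (suc k) S S≤k _ _ _ u | inj₂ (_ , conn′ , deg′ , _) | S′ , lt , in-S′ =
    min-degree-minor k S′ (≤-pred (<-≤-trans lt S≤k)) in-S′ conn′ deg′ u

-- Placing vertices by undoing contractions

module Realisation {n m} (en : Fin m → Fin n × Fin n) (σ : Fin m → Bool)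
    (connected : Connected (finSG n m en σ)) (K4-free : K4MinorFree (finSG n m en σ)) (root : Fin n)
    {g : ℕ} {w : Fin n → Fin n → ℕ} (w-self : ∀ u → w u u ≡ 0) (w-sym : ∀ u v → w u v ≡ w v u)
    (w-tripod : ∀ x y v → Tripod (w x y) (w x v) (w y v) g)
    {Pt : Set} {d : Pt → Pt → ℕ} (origin : Pt) (d-self : ∀ P → d P P ≡ 0) (d-sym : ∀ P Q → d P Q ≡ d Q P)
    (place : ∀ {p q r} P Q → d P Q ≡ p → Tripod p q r g → ∃ λ R → d P R ≡ q × d Q R ≡ r) where

  open Contraction en σ
  open Adj

  -- x and y may coincide, which covers degree one.
  data Low (ρ : Fin n → Fin n) (v : Fin n) : Set where
    isolated : (∀ z → ¬ Adj ρ v z) → Low ρ v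
    between₂ : ∀ x y → Adj ρ v x → Adj ρ v y → (∀ z → Adj ρ v z → z ≡ x ⊎ z ≡ y) → Low ρ v

  degree≥3-or-low : ∀ ρ v → AtLeast 3 (Adj ρ v) ⊎ Low ρ v
  degree≥3-or-low ρ v with any? (adj? ρ v)
  ... | no ¬z = inj₂ (isolated λ z vz → ¬z (z , vz))
  ... | yes (x , vx) with any? (λ z → adj? ρ v z ×-dec ¬? (z ≟ x))
  ...   | no ¬z = inj₂ (between₂ x x vx vx only)
    where
    only : ∀ z → Adj ρ v z → z ≡ x ⊎ z ≡ x
    only z vz with z ≟ x
    ... | yes z≡x = inj₁ z≡x
    ... | no z≢x  = contradiction (z , vz , z≢x) ¬z
  ...   | yes (y , vy , y≢x) with any? (λ z → (adj? ρ v z ×-dec ¬? (z ≟ x)) ×-dec ¬? (z ≟ y))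
  ...     | yes (z , (vz , z≢x) , z≢y) = inj₁ (x , vx , y , (vy , y≢x) , z , ((vz , z≢x) , z≢y) , _)
  ...     | no ¬z = inj₂ (between₂ x y vx vy only)
    where
    only : ∀ z → Adj ρ v z → z ≡ x ⊎ z ≡ y
    only z vz with z ≟ x | z ≟ y
    ... | yes z≡x | _       = inj₁ z≡x
    ... | _       | yes z≡y = inj₂ z≡y
    ... | no z≢x  | no z≢y  = contradiction (z , (vz , z≢x) , z≢y) ¬z

  Realises : (Fin n → Fin n) → (Fin n → Pt) → Set
  Realises ρ f = ∀ x y → Adj ρ x y → d (f x) (f y) ≡ w x y

  -- As G is connected, all of it lies over the isolated vertex; the contraction has no adjacent
  -- pair, and any map will do.
  realise-isolated : ∀ {ρ} u → (∀ z → ¬ Adj ρ (ρ u) z) → Realises ρ (const origin)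
  realise-isolated {ρ} u alone x y xy with adj-edge xy
  ... | p , q , refl , refl , _ = contradiction (trans (sym (constant (connected u p))) (constant (connected u q))) (distinct xy)
    where
    same : ∀ {r s} → ρ r ≡ ρ u → Step G r s → ρ s ≡ ρ u
    same {r} {s} eq st with ρ r ≟ ρ s
    ... | yes eq′ = trans (sym eq′) eq
    ... | no ne   = contradiction (subst (λ z → Adj ρ z (ρ s)) eq (edge-adj st ne)) (alone (ρ s))
    along : ∀ {r s} → ρ r ≡ ρ u → Walk G r s → ρ s ≡ ρ u
    along eq []       = eq
    along eq (st ∷ W) = along (same eq st) W
    constant : ∀ {s} → Walk G u s → ρ u ≡ ρ s
    constant W = sym (along refl W)

  -- Contracting v into x makes x and y adjacent, so f already has them at distance w x y, whether
  -- or not G has an edge there. This is the premise needed to place v.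
  extend : ∀ {ρ v x y f} → Adj ρ v x → Adj ρ v y → (∀ z → Adj ρ v z → z ≡ x ⊎ z ≡ y) →
    Realises (contract v x ∘ ρ) f → ∃ (Realises ρ)
  extend {ρ} {v} {x} {y} {f} vx vy only real = f′ , real′
    where
    fixed : ∀ {z} → z ≢ v → contract v x z ≡ z
    fixed = contract-≢ x
    base : d (f x) (f y) ≡ w x y
    base with x ≟ y
    ... | yes refl = trans (d-self (f x)) (sym (w-self x))
    ... | no x≢y   = real x y (adj-map (contract v x) vy (contract-≡ v x) (fixed (≢-sym (distinct vy))) x≢y)
    placed : ∃ λ R → d (f x) R ≡ w x v × d (f y) R ≡ w y v
    placed = place (f x) (f y) base (w-tripod x y v)
    R : Pt
    R = proj₁ placed
    f′ : Fin n → Pt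
    f′ = updateAt f v (const R)
    f′v : f′ v ≡ R
    f′v = updateAt-updates v f
    f′z : ∀ {z} → z ≢ v → f′ z ≡ f z
    f′z z≢v = updateAt-minimal _ v f z≢v
    near : ∀ z → Adj ρ v z → d (f′ z) R ≡ w z v
    near z vz with only z vz
    ... | inj₁ refl = trans (cong (λ P → d P R) (f′z (≢-sym (distinct vz)))) (proj₁ (proj₂ placed))
    ... | inj₂ refl = trans (cong (λ P → d P R) (f′z (≢-sym (distinct vz)))) (proj₂ (proj₂ placed))
    real′ : Realises ρ f′
    real′ p q pq = go (p ≟ v) (q ≟ v)
      where
      go : Dec (p ≡ v) → Dec (q ≡ v) → d (f′ p) (f′ q) ≡ w p q
      go (yes refl) _ = trans (d-sym (f′ v) (f′ q)) (trans (cong (d (f′ q)) f′v) (trans (near q pq) (w-sym q v)))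
      go (no _) (yes refl) = trans (cong (d (f′ p)) f′v) (near p (adj-sym pq))
      go (no p≢v) (no q≢v) = trans (cong₂ d (f′z p≢v) (f′z q≢v))
        (real p q (adj-map (contract v x) pq (fixed p≢v) (fixed q≢v) (distinct pq)))

  realise-contraction : ∀ k ρ S → card S ≤ k → (∀ u → ρ u ∈ S) → Connects ρ → ∃ (Realises ρ)
  realise-contraction k ρ S S≤k in-S conn with ⊎-search (λ u → degree≥3-or-low ρ (ρ u))
  ... | inj₁ deg = contradiction (min-degree-minor (card S) S ≤-refl in-S conn deg root) K4-free
  ... | inj₂ (u , isolated alone) = const origin , realise-isolated u alone
  ... | inj₂ (u , between₂ x y vx vy only) with shrinks-contract vx S in-S
  realise-contraction zero ρ S S≤k in-S conn | inj₂ _ | S′ , lt , _ = contradiction (<-≤-trans lt S≤k) λ ()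
  realise-contraction (suc k) ρ S S≤k in-S conn | inj₂ (u , between₂ x y vx vy only) | S′ , lt , in-S′
    with realise-contraction k (contract (ρ u) x ∘ ρ) S′ (≤-pred (<-≤-trans lt S≤k)) in-S′ (connects-contract vx conn)
  ... | f , real = extend vx vy only real

  realise : ∃ (Realises id)
  realise = realise-contraction (card (everything {n})) id everything ≤-refl (λ _ → ∈⊤) connects-id

-- The signed graph TT(g)

half : Bool → Fin 2
half false = zero
half true  = suc zero

position : ∀ {m} → Cyc m → Fin (2 * m)
position (i , s) = combine (half s) i

offset : ∀ {m} → Cyc m → ℕ
offset (i , false)     = toℕ i
offset {m} (i , true)  = m + toℕ i

toℕ-position : ∀ {m} (X : Cyc m) → toℕ (position X) ≡ offset X
toℕ-position {m} (i , false) = trans (toℕ-combine (zero {1}) i) (cong (_+ toℕ i) (*-zeroʳ m))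
toℕ-position {m} (i , true)  = trans (toℕ-combine (suc (zero {0})) i) (cong (_+ toℕ i) (*-identityʳ m))

unhalf : Fin 2 → Bool
unhalf zero       = false
unhalf (suc zero) = true

half-unhalf : ∀ x → half (unhalf x) ≡ x
half-unhalf zero       = refl
half-unhalf (suc zero) = refl

unposition : ∀ {m} → Fin (2 * m) → Cyc m
unposition {m} k = proj₂ (remQuot {2} m k) , unhalf (proj₁ (remQuot {2} m k))

position-unposition : ∀ {m} (k : Fin (2 * m)) → position (unposition {m} k) ≡ k
position-unposition {m} k = trans
  (cong (λ x → combine x (proj₂ (remQuot {2} m k))) (half-unhalf (proj₁ (remQuot {2} m k)))) (combine-remQuot {2} m k)

offset-unposition : ∀ {m} (k : Fin (2 * m)) → offset (unposition {m} k) ≡ toℕ k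
offset-unposition {m} k = trans (sym (toℕ-position (unposition {m} k))) (cong toℕ (position-unposition {m} k))

Succ : ℕ → ℕ → ℕ → Set
Succ n i i′ = i′ ≡ suc i ⊎ (suc i ≡ n × i′ ≡ 0)

∣-∣≡1 : ∀ i j → ∣ i - j ∣ ≡ 1 → j ≡ suc i ⊎ i ≡ suc j
∣-∣≡1 zero    j       eq = inj₁ eq
∣-∣≡1 (suc i) zero    eq = inj₂ eq
∣-∣≡1 (suc i) (suc j) eq with ∣-∣≡1 i j eq
... | inj₁ e = inj₁ (cong suc e)
... | inj₂ e = inj₂ (cong suc e)

∣-suc∣≡1 : ∀ i → ∣ i - suc i ∣ ≡ 1
∣-suc∣≡1 zero    = refl
∣-suc∣≡1 (suc i) = ∣-suc∣≡1 i

∸≡0⇒far : ∀ {m} (i j : Fin m) → m ∸ ∣ toℕ i - toℕ j ∣ ≢ 0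
∸≡0⇒far i j eq = <⇒≱ (≤-<-trans (∣m-n∣≤m⊔n (toℕ i) (toℕ j)) (⊔-pres-<m (toℕ<n i) (toℕ<n j))) (m∸n≡0⇒m≤n eq)

-- The gap is m - 1, the largest possible one, and only the two ends of the range attain it.
ends-apart : ∀ {m i j} → i < m → j < m → m ∸ ∣ i - j ∣ ≡ 1 → (i ≡ 0 × suc j ≡ m) ⊎ (suc i ≡ m × j ≡ 0)
ends-apart {m} {i} {j} i<m j<m eq = [ (λ i≤j → inj₁ (sorted i≤j j<m (trans (cong (m ∸_) (sym (m≤n⇒∣m-n∣≡n∸m i≤j))) eq))) ,
    (λ j≤i → inj₂ (swap-× (sorted j≤i i<m (trans (cong (m ∸_) (sym (m≤n⇒∣n-m∣≡n∸m j≤i))) eq)))) ]′ (≤-total i j)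
  where
  sorted : ∀ {i j} → i ≤ j → j < m → m ∸ (j ∸ i) ≡ 1 → i ≡ 0 × suc j ≡ m
  sorted {i} {j} i≤j j<m eq = i≡0 , trans (cong suc (trans (sym (m+[n∸m]≡n i≤j)) (cong (_+ (j ∸ i)) i≡0))) sd≡m
    where
    sd≡m : suc (j ∸ i) ≡ m
    sd≡m = trans (cong (_+ (j ∸ i)) (sym eq)) (m∸n+n≡m (≤-trans (m∸n≤m j i) (<⇒≤ j<m)))
    i≡0 : i ≡ 0
    i≡0 = n≤0⇒n≡0 (+-cancelʳ-≤ (j ∸ i) i 0 (≤-pred (subst₂ _<_ (sym (m+[n∸m]≡n i≤j)) (sym sd≡m) j<m)))

far-end : ∀ {m j} → suc j ≡ m → m ∸ j ≡ 1
far-end {j = j} refl = m+n∸n≡m 1 j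

2*-+ : ∀ m → 2 * m ≡ m + m
2*-+ = solve-∀

dC≡0 : ∀ {m} (X Y : Cyc m) → dC X Y ≡ 0 → X ≡ Y
dC≡0 (i , false) (j , false) eq = cong (_, false) (toℕ-injective (∣m-n∣≡0⇒m≡n eq))
dC≡0 (i , true)  (j , true)  eq = cong (_, true) (toℕ-injective (∣m-n∣≡0⇒m≡n eq))
dC≡0 (i , false) (j , true)  eq = contradiction eq (∸≡0⇒far i j)
dC≡0 (i , true)  (j , false) eq = contradiction eq (∸≡0⇒far i j)

dC≡1⇒Succ : ∀ {m} (X Y : Cyc m) → dC X Y ≡ 1 → Succ (2 * m) (offset X) (offset Y) ⊎ Succ (2 * m) (offset Y) (offset X)
dC≡1⇒Succ (i , false) (j , false) eq = [ inj₁ ∘ inj₁ , inj₂ ∘ inj₁ ]′ (∣-∣≡1 (toℕ i) (toℕ j) eq)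
dC≡1⇒Succ {m} (i , true) (j , true) eq =
  [ (λ e → inj₁ (inj₁ (shift e))) , (λ e → inj₂ (inj₁ (shift e))) ]′ (∣-∣≡1 (toℕ i) (toℕ j) eq)
  where
  shift : ∀ {k l} → l ≡ suc k → m + l ≡ suc (m + k)
  shift {k} refl = +-suc m k
-- The halves meet at two places of the 2m-cycle: between 2m - 1 and 0, and between m - 1 and m.
dC≡1⇒Succ {m} (i , false) (j , true) eq with ends-apart (toℕ<n i) (toℕ<n j) eq
... | inj₁ (i≡0 , sj≡m) = inj₂ (inj₂ (trans (sym (+-suc m (toℕ j))) (trans (cong (m +_) sj≡m) (sym (2*-+ m))) , i≡0))
... | inj₂ (si≡m , j≡0) = inj₁ (inj₁ (trans (cong (m +_) j≡0) (trans (+-identityʳ m) (sym si≡m))))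
dC≡1⇒Succ {m} X@(i , true) Y@(j , false) eq =
  [ inj₂ , inj₁ ]′ (dC≡1⇒Succ Y X (trans (dC-sym Y X) eq))

Succ⇒dC≡1 : ∀ {m} (X Y : Cyc m) → Succ (2 * m) (offset X) (offset Y) → dC X Y ≡ 1
Succ⇒dC≡1 (i , false) (j , false) (inj₁ eq) = trans (cong ∣ toℕ i -_∣ eq) (∣-suc∣≡1 (toℕ i))
Succ⇒dC≡1 {m} (i , true) (j , true) (inj₁ eq) =
  trans (cong ∣ toℕ i -_∣ (+-cancelˡ-≡ m _ _ (trans eq (sym (+-suc m (toℕ i)))))) (∣-suc∣≡1 (toℕ i))
Succ⇒dC≡1 {m} (i , false) (j , true) (inj₁ eq) =
  trans (cong (λ k → m ∸ ∣ toℕ i - k ∣) j≡0) (trans (cong (m ∸_) (∣-∣-identityʳ (toℕ i))) (far-end (≤-antisym (toℕ<n i) (subst (m ≤_) eq (m≤m+n m (toℕ j))))))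
  where
  j≡0 : toℕ j ≡ 0
  j≡0 = n≤0⇒n≡0 (+-cancelˡ-≤ m (toℕ j) 0 (≤-trans (≤-reflexive eq) (≤-trans (toℕ<n i) (≤-reflexive (sym (+-identityʳ m))))))
Succ⇒dC≡1 {m} (i , true) (j , false) (inj₁ eq) =
  contradiction (subst (_< m) eq (toℕ<n j)) (≤⇒≯ (≤-trans (m≤m+n m (toℕ i)) (n≤1+n _)))
Succ⇒dC≡1 {m} (i , false) (j , t) (inj₂ (eq , _)) =
  contradiction (subst (_≤ m) (trans eq (2*-+ m)) (toℕ<n i)) (<⇒≱ (m<m+n m (≤-<-trans z≤n (toℕ<n i))))
Succ⇒dC≡1 {m} (i , true) (j , true) (inj₂ (_ , eq)) =
  contradiction (≤-<-trans z≤n (toℕ<n i)) (≤⇒≯ (subst (m ≤_) eq (m≤m+n m (toℕ j))))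
Succ⇒dC≡1 {m} (i , true) (j , false) (inj₂ (eq , eq′)) =
  trans (cong (λ k → m ∸ ∣ toℕ i - k ∣) eq′) (trans (cong (m ∸_) (∣-∣-identityʳ (toℕ i)))
    (far-end (+-cancelˡ-≡ m _ _ (trans (+-suc m (toℕ i)) (trans eq (2*-+ m))))))

offset-flip : ∀ {m} (X Y : Cyc m) → offset Y + m ≡ offset X → Y ≡ flip X
offset-flip {m} (i , false) Y eq = contradiction (toℕ<n i) (≤⇒≯ (subst (m ≤_) eq (m≤n+m m (offset Y))))
offset-flip {m} (i , true) (j , true) eq =
  contradiction (toℕ<n i) (≤⇒≯ (subst (m ≤_) (+-cancelˡ-≡ m _ _ (trans (sym (+-assoc m (toℕ j) m)) eq)) (m≤n+m m (toℕ j))))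
offset-flip {m} (i , true) (j , false) eq = cong (_, false) (toℕ-injective (+-cancelˡ-≡ m _ _ (trans (+-comm m (toℕ j)) eq)))

antip-offset : ∀ {m} (i : Fin m) s → offset (i , s) + m ≡ offset (i , not s) ⊎ offset (i , not s) + m ≡ offset (i , s)
antip-offset {m} i false = inj₁ (+-comm (toℕ i) m)
antip-offset {m} i true  = inj₂ (+-comm (toℕ i) m)

-- The parity of the offset, hence the bipartition of the 2m-cycle.
classC : ∀ {m} → Cyc m → Bool
classC {m} (i , s) = odd (toℕ i) xor (s ∧ odd m)

odd-dC : ∀ {m} (X Y : Cyc m) → odd (dC X Y) ≡ classC X xor classC Y
odd-dC {m} (i , s) (j , t) = trans (odd-arc (gap≤ i j) (s xor t)) (trans (cong (_xor ((s xor t) ∧ odd m)) (odd-∣-∣ (toℕ i) (toℕ j)))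
  (solve 5 (λ i s j t m → (i :+ j) :+ ((s :+ t) :* m) := (i :+ (s :* m)) :+ (j :+ (t :* m))) refl (odd (toℕ i)) s (odd (toℕ j)) t (odd m)))
  where open xor-∧-Solver

-- TT(g) as the quotient of the torus by the antipodal map

module Twisted (g : ℕ) where
  a = aOf g
  b = bOf g

  -- The half t = false of the torus is the cylinder T(g) and represents all antipodal pairs. A
  -- point with t = true is replaced by its antipode, which flips s.
  project : Torus a b → VT g
  project ((i , s) , (j , t)) = position (i , s xor t) , j

  layer : Torus a b → Bool
  layer (_ , (_ , t)) = t

  data AdjacentT : VT g → VT g → Set where
    horizontal : ∀ {k k′ j j′} → toℕ j ≡ toℕ j′ → Succ (2 * a) (toℕ k) (toℕ k′) ⊎ Succ (2 * a) (toℕ k′) (toℕ k) → AdjacentT (k , j) (k′ , j′)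
    vertical   : ∀ {k k′ j j′} → toℕ k ≡ toℕ k′ → toℕ j′ ≡ suc (toℕ j) ⊎ toℕ j ≡ suc (toℕ j′) → AdjacentT (k , j) (k′ , j′)

  data AdjacentJ : VT g → VT g → Set where
    antipodal : ∀ {k k′ j j′} → (toℕ j ≡ 0 × toℕ j′ ≡ b ∸ 1) ⊎ (toℕ j′ ≡ 0 × toℕ j ≡ b ∸ 1) →
      toℕ k′ + a ≡ toℕ k ⊎ toℕ k + a ≡ toℕ k′ → AdjacentJ (k , j) (k′ , j′)

  AdjacentT-sym : ∀ {u v} → AdjacentT u v → AdjacentT v u
  AdjacentT-sym (horizontal eq s) = horizontal (sym eq) (swap-⊎ s)
  AdjacentT-sym (vertical eq s)   = vertical (sym eq) (swap-⊎ s)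

  AdjacentJ-sym : ∀ {u v} → AdjacentJ u v → AdjacentJ v u
  AdjacentJ-sym (antipodal e s) = antipodal (swap-⊎ e) (swap-⊎ s)

  succMod⇔ : ∀ n i i′ → (T (succMod n i i′) → Succ n i i′) × (Succ n i i′ → T (succMod n i i′))
  succMod⇔ n i i′ =
    (λ t → [ (λ e → inj₁ (≡ᵇ⇒≡ i′ (suc i) e)) , (λ p → inj₂ (≡ᵇ⇒≡ (suc i) n (proj₁ (to T-∧ p)) , ≡ᵇ⇒≡ i′ 0 (proj₂ (to T-∧ p)))) ]′ (to T-∨ t)) ,
    (λ { (inj₁ e) → from T-∨ (inj₁ (≡⇒≡ᵇ i′ (suc i) e))
       ; (inj₂ (e , e′)) → from (T-∨ {i′ ≡ᵇ suc i}) (inj₂ (from T-∧ (≡⇒≡ᵇ (suc i) n e , ≡⇒≡ᵇ i′ 0 e′))) })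

  adjT-sound : ∀ u v → T (adjT g u v) → AdjacentT u v
  adjT-sound (k , j) (k′ , j′) t with to (T-∨ {(toℕ j ≡ᵇ toℕ j′) ∧ _}) t
  ... | inj₁ h with to (T-∧ {toℕ j ≡ᵇ toℕ j′}) h
  ...   | e , s = horizontal (≡ᵇ⇒≡ _ _ e)
    ([ inj₁ ∘ proj₁ (succMod⇔ (2 * a) (toℕ k) (toℕ k′)) , inj₂ ∘ proj₁ (succMod⇔ (2 * a) (toℕ k′) (toℕ k)) ]′ (to T-∨ s))
  adjT-sound (k , j) (k′ , j′) t | inj₂ h with to (T-∧ {toℕ k ≡ᵇ toℕ k′}) h
  ...   | e , s = vertical (≡ᵇ⇒≡ _ _ e)
    ([ inj₁ ∘ ≡ᵇ⇒≡ _ _ , inj₂ ∘ ≡ᵇ⇒≡ _ _ ]′ (to (T-∨ {toℕ j′ ≡ᵇ suc (toℕ j)}) s))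

  adjT-complete : ∀ {u v} → AdjacentT u v → T (adjT g u v)
  adjT-complete (horizontal {k} {k′} {j} {j′} e s) = from T-∨ (inj₁ (from T-∧ (≡⇒≡ᵇ _ _ e , from T-∨
    ([ inj₁ ∘ proj₂ (succMod⇔ (2 * a) (toℕ k) (toℕ k′)) , inj₂ ∘ proj₂ (succMod⇔ (2 * a) (toℕ k′) (toℕ k)) ]′ s))))
  adjT-complete (vertical {k} {k′} {j} {j′} e s) = from (T-∨ {(toℕ j ≡ᵇ toℕ j′) ∧ _}) (inj₂ (from T-∧ (≡⇒≡ᵇ _ _ e , from T-∨
    ([ inj₁ ∘ ≡⇒≡ᵇ _ _ , inj₂ ∘ ≡⇒≡ᵇ _ _ ]′ s))))

  antip⇔ : ∀ i i′ → (T (antip g i i′) → i′ + a ≡ i ⊎ i + a ≡ i′) × (i′ + a ≡ i ⊎ i + a ≡ i′ → T (antip g i i′))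
  antip⇔ i i′ = (λ t → [ inj₁ ∘ ≡ᵇ⇒≡ _ _ , inj₂ ∘ ≡ᵇ⇒≡ _ _ ]′ (to (T-∨ {i′ + a ≡ᵇ i}) t)) ,
    λ s → from (T-∨ {i′ + a ≡ᵇ i}) ([ inj₁ ∘ ≡⇒≡ᵇ _ _ , inj₂ ∘ ≡⇒≡ᵇ _ _ ]′ s)

  adjJ-sound : ∀ u v → T (adjJ g u v) → AdjacentJ u v
  adjJ-sound (k , j) (k′ , j′) t with to (T-∨ {(toℕ j ≡ᵇ 0) ∧ _}) t
  ... | inj₁ h with to (T-∧ {toℕ j ≡ᵇ 0}) h
  ...   | e , h′ with to (T-∧ {toℕ j′ ≡ᵇ b ∸ 1}) h′
  ...     | e′ , s = antipodal (inj₁ (≡ᵇ⇒≡ _ _ e , ≡ᵇ⇒≡ _ _ e′)) (proj₁ (antip⇔ _ _) s)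
  adjJ-sound (k , j) (k′ , j′) t | inj₂ h with to (T-∧ {toℕ j′ ≡ᵇ 0}) h
  ...   | e , h′ with to (T-∧ {toℕ j ≡ᵇ b ∸ 1}) h′
  ...     | e′ , s = antipodal (inj₂ (≡ᵇ⇒≡ _ _ e , ≡ᵇ⇒≡ _ _ e′)) (proj₁ (antip⇔ _ _) s)

  adjJ-complete : ∀ {u v} → AdjacentJ u v → T (adjJ g u v)
  adjJ-complete (antipodal (inj₁ (e , e′)) s) =
    from T-∨ (inj₁ (from T-∧ (≡⇒≡ᵇ _ _ e , from T-∧ (≡⇒≡ᵇ _ _ e′ , proj₂ (antip⇔ _ _) s))))
  adjJ-complete (antipodal {j = j} {j′} (inj₂ (e , e′)) s) =
    from (T-∨ {(toℕ j ≡ᵇ 0) ∧ _}) (inj₂ (from T-∧ (≡⇒≡ᵇ _ _ e , from T-∧ (≡⇒≡ᵇ _ _ e′ , proj₂ (antip⇔ _ _) s))))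

  code-injective : ∀ u v → code g u ≡ code g v → u ≡ v
  code-injective (k , j) (k′ , j′) eq with combine-injective j k j′ k′ (toℕ-injective (trans (toℕ-combine j k) (trans (cong (_+ toℕ k) (*-comm (2 * a) (toℕ j)))
    (trans eq (sym (trans (toℕ-combine j′ k′) (cong (_+ toℕ k′) (*-comm (2 * a) (toℕ j′)))))))))
  ... | refl , refl = refl

  Edge : Bool → VT g → VT g → Set
  Edge s u v = Σ (E (TTJ g)) λ e → (ends (TTJ g) e ≡ (u , v) ⊎ ends (TTJ g) e ≡ (v , u)) × sign (TTJ g) e ≡ s

  ordered : ∀ u v → u ≢ v → T (code g u <ᵇ code g v) ⊎ T (code g v <ᵇ code g u)
  ordered u v u≢v with <-cmp (code g u) (code g v)
  ... | tri< lt _ _ = inj₁ (<⇒<ᵇ lt)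
  ... | tri≈ _ eq _ = contradiction (code-injective u v eq) u≢v
  ... | tri> _ _ gt = inj₂ (<⇒<ᵇ gt)

  2m≢1 : ∀ m → 2 * m ≢ 1
  2m≢1 (suc m) eq = contradiction (trans (sym (+-suc m (m + 0))) (suc-injective eq)) λ ()

  AdjacentT-irreflexive : ∀ {u} → ¬ AdjacentT u u
  AdjacentT-irreflexive (horizontal _ s) = [ absurd , absurd ]′ s
    where
    absurd : ∀ {k} → ¬ Succ (2 * a) k k
    absurd (inj₁ eq)         = 1+n≢n (sym eq)
    absurd (inj₂ (eq , eq′)) = 2m≢1 a (trans (sym eq) (cong suc eq′))
  AdjacentT-irreflexive (vertical _ s) = [ (λ eq → 1+n≢n (sym eq)) , (λ eq → 1+n≢n (sym eq)) ]′ s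

  AdjacentJ-irreflexive : ∀ {u} → ¬ AdjacentJ u u
  AdjacentJ-irreflexive {k , _} (antipodal _ s) = [ absurd , absurd ]′ s
    where
    absurd : toℕ k + a ≢ toℕ k
    absurd eq = contradiction (toℕ<n k) (subst (λ m → ¬ (toℕ k < 2 * m)) (sym (m+n≡m⇒n≡0 (toℕ k) eq)) λ ())
      where
      m+n≡m⇒n≡0 : ∀ m {n} → m + n ≡ m → n ≡ 0
      m+n≡m⇒n≡0 m eq = +-cancelˡ-≡ m _ _ (trans eq (sym (+-identityʳ m)))

  edgeT : ∀ {u v} → AdjacentT u v → Edge false u v
  edgeT {u} {v} adj with ordered u v (λ { refl → AdjacentT-irreflexive adj })
  ... | inj₁ lt = inj₁ ((u , v) , from T-∧ (lt , adjT-complete adj)) , inj₁ refl , refl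
  ... | inj₂ lt = inj₁ ((v , u) , from T-∧ (lt , adjT-complete (AdjacentT-sym adj))) , inj₂ refl , refl

  edgeJ : ∀ {u v} → AdjacentJ u v → Edge true u v
  edgeJ {u} {v} adj with ordered u v (λ { refl → AdjacentJ-irreflexive adj })
  ... | inj₁ lt = inj₂ ((u , v) , from T-∧ (lt , adjJ-complete adj)) , inj₁ refl , refl
  ... | inj₂ lt = inj₂ ((v , u) , from T-∧ (lt , adjJ-complete (AdjacentJ-sym adj))) , inj₂ refl , refl

  rotate : ∀ (X X′ : Cyc a) t → dC (proj₁ X , proj₂ X xor t) (proj₁ X′ , proj₂ X′ xor t) ≡ dC X X′
  rotate (i , s) (i′ , s′) t = cong (arc a ∣ toℕ i - toℕ i′ ∣)
    (solve 3 (λ s s′ t → (s :+ t) :+ (s′ :+ t) := s :+ s′) refl s s′ t)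
    where open xor-∧-Solver

  horizontal-edge : ∀ (X X′ : Cyc a) (Y : Cyc b) → dC X X′ ≡ 1 → AdjacentT (project (X , Y)) (project (X′ , Y))
  horizontal-edge X X′ (j , t) eq = horizontal refl
    (subst₂ (λ k k′ → Succ (2 * a) k k′ ⊎ Succ (2 * a) k′ k) (sym (toℕ-position X₁)) (sym (toℕ-position X₂))
      (dC≡1⇒Succ X₁ X₂ (trans (rotate X X′ t) eq)))
    where
    X₁ X₂ : Cyc a
    X₁ = proj₁ X , proj₂ X xor t
    X₂ = proj₁ X′ , proj₂ X′ xor t

  antipodal-edge : ∀ (i : Fin a) s (j j′ : Fin b) → b ∸ ∣ toℕ j - toℕ j′ ∣ ≡ 1 →
    AdjacentJ (position (i , s) , j) (position (i , not s) , j′)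
  antipodal-edge i s j j′ eq = antipodal (rows (ends-apart (toℕ<n j) (toℕ<n j′) eq))
    (swap-⊎ (subst₂ (λ k k′ → k + a ≡ k′ ⊎ k′ + a ≡ k) (sym (toℕ-position (i , s))) (sym (toℕ-position (i , not s))) (antip-offset i s)))
    where
    rows : (toℕ j ≡ 0 × suc (toℕ j′) ≡ b) ⊎ (suc (toℕ j) ≡ b × toℕ j′ ≡ 0) →
      (toℕ j ≡ 0 × toℕ j′ ≡ b ∸ 1) ⊎ (toℕ j′ ≡ 0 × toℕ j ≡ b ∸ 1)
    rows (inj₁ (e , e′)) = inj₁ (e , cong pred e′)
    rows (inj₂ (e , e′)) = inj₂ (e′ , cong pred e)

  -- Inside one half of C_2b the step is vertical in T(g). A step between the halves joins opposite
  -- ends of P_b, and taking the antipode of one endpoint turns the first coordinate by a: this is a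
  -- J-edge.
  vertical-edge : ∀ (X : Cyc a) (Y Y′ : Cyc b) → dC Y Y′ ≡ 1 →
    Edge (proj₂ Y xor proj₂ Y′) (project (X , Y)) (project (X , Y′))
  vertical-edge X (j , false) (j′ , false) eq = edgeT (vertical refl (∣-∣≡1 (toℕ j) (toℕ j′) eq))
  vertical-edge X (j , true)  (j′ , true)  eq = edgeT (vertical refl (∣-∣≡1 (toℕ j) (toℕ j′) eq))
  vertical-edge (i , false) (j , false) (j′ , true)  eq = edgeJ (antipodal-edge i false j j′ eq)
  vertical-edge (i , false) (j , true)  (j′ , false) eq = edgeJ (antipodal-edge i true  j j′ eq)
  vertical-edge (i , true)  (j , false) (j′ , true)  eq = edgeJ (antipodal-edge i true  j j′ eq)
  vertical-edge (i , true)  (j , true)  (j′ , false) eq = edgeJ (antipodal-edge i false j j′ eq)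

  torus-edge : ∀ P Q → dT P Q ≡ 1 → Edge (layer P xor layer Q) (project P) (project Q)
  torus-edge (X , Y) (X′ , Y′) eq with dC X X′ in eqX | dC Y Y′ in eqY
  torus-edge (X , Y) (X′ , Y′) refl | zero | _ with dC≡0 X X′ eqX
  ... | refl = vertical-edge X Y Y′ eqY
  torus-edge (X , Y) (X′ , Y′) eq | suc zero | zero with dC≡0 Y Y′ eqY
  ... | refl = subst (λ s → Edge s (project (X , Y)) (project (X′ , Y))) (sym (xor-same (proj₂ Y)))
    (edgeT (horizontal-edge X X′ Y eqX))

  shift : Bool → Torus a b → Torus a b
  shift false P = P
  shift true  P = antipode P

  layer-shift : ∀ s P → layer (shift s P) ≡ s xor layer P
  layer-shift false P = refl
  layer-shift true  P = refl

  project-shift : ∀ s P → project (shift s P) ≡ project P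
  project-shift false P = refl
  project-shift true ((i , s) , (j , t)) = cong (λ r → position (i , r) , j) (xor-interchange true s true t)

  lift : VT g → Torus a b
  lift (k , j) = unposition k , (j , false)

  dT-AdjacentT : ∀ {u v} → AdjacentT u v → dT (lift u) (lift v) ≡ 1
  dT-AdjacentT (horizontal {k} {k′} {j} {j′} eq s) with toℕ-injective eq
  ... | refl = cong₂ _+_ (go s) (∣n-n∣≡0 (toℕ j))
    where
    forward : ∀ k k′ → Succ (2 * a) (toℕ k) (toℕ k′) → dC (unposition {a} k) (unposition {a} k′) ≡ 1
    forward k k′ s = Succ⇒dC≡1 (unposition {a} k) (unposition {a} k′)
      (subst₂ (Succ (2 * a)) (sym (offset-unposition {a} k)) (sym (offset-unposition {a} k′)) s)
    go : Succ (2 * a) (toℕ k) (toℕ k′) ⊎ Succ (2 * a) (toℕ k′) (toℕ k) → dC (unposition {a} k) (unposition {a} k′) ≡ 1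
    go (inj₁ s) = forward k k′ s
    go (inj₂ s) = trans (dC-sym (unposition {a} k) (unposition {a} k′)) (forward k′ k s)
  dT-AdjacentT (vertical {k} {k′} {j} {j′} eq s) with toℕ-injective eq
  ... | refl = cong₂ _+_ (dC-refl (unposition {a} k)) (go s)
    where
    go : toℕ j′ ≡ suc (toℕ j) ⊎ toℕ j ≡ suc (toℕ j′) → ∣ toℕ j - toℕ j′ ∣ ≡ 1
    go (inj₁ e) = trans (cong ∣ toℕ j -_∣ e) (∣-suc∣≡1 (toℕ j))
    go (inj₂ e) = trans (cong ∣_- toℕ j′ ∣ e) (trans (∣-∣-comm (suc (toℕ j′)) (toℕ j′)) (∣-suc∣≡1 (toℕ j′)))

  dT-AdjacentJ : ∀ {u v} → AdjacentJ u v → dT (lift u) (antipode (lift v)) ≡ 1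
  dT-AdjacentJ (antipodal {k} {k′} {j} {j′} e s) = cong₂ _+_ (go s) (ends-far e)
    where
    same : ∀ (X Y : Cyc a) → Y ≡ flip X → dC X (flip Y) ≡ 0
    same X .(flip X) refl = trans (sym (dC-flipˡ X (flip X))) (dC-refl (flip X))
    offsets : ∀ k k′ → toℕ k′ + a ≡ toℕ k → unposition {a} k′ ≡ flip (unposition {a} k)
    offsets k k′ eq = offset-flip (unposition {a} k) (unposition {a} k′)
      (trans (cong (_+ a) (offset-unposition {a} k′)) (trans eq (sym (offset-unposition {a} k))))
    go : toℕ k′ + a ≡ toℕ k ⊎ toℕ k + a ≡ toℕ k′ → dC (unposition {a} k) (flip (unposition {a} k′)) ≡ 0
    go (inj₁ eq) = same (unposition {a} k) (unposition {a} k′) (offsets k k′ eq)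
    go (inj₂ eq) = trans (cong (λ X → dC X (flip (unposition {a} k′))) (offsets k′ k eq)) (dC-refl (flip (unposition {a} k′)))
    last : ∀ {m} (j : Fin m) → toℕ j ≡ m ∸ 1 → suc (toℕ j) ≡ m
    last {suc m} j eq = cong suc eq
    ends-far : (toℕ j ≡ 0 × toℕ j′ ≡ b ∸ 1) ⊎ (toℕ j′ ≡ 0 × toℕ j ≡ b ∸ 1) → b ∸ ∣ toℕ j - toℕ j′ ∣ ≡ 1
    ends-far (inj₁ (e , e′)) = trans (cong (λ x → b ∸ ∣ x - toℕ j′ ∣) e) (far-end (last j′ e′))
    ends-far (inj₂ (e , e′)) = trans (cong (λ x → b ∸ ∣ toℕ j - x ∣) e)
      (trans (cong (b ∸_) (∣-∣-identityʳ (toℕ j))) (far-end (last j e′)))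

  dT-step : ∀ {u v} (s : Step (TTJ g) u v) → dT (lift u) (shift (sign (TTJ g) (stepEdge s)) (lift v)) ≡ 1
  dT-step {u} {v} (fwd (inj₁ (._ , t)) refl) = dT-AdjacentT (adjT-sound u v (proj₂ (to T-∧ t)))
  dT-step {u} {v} (bwd (inj₁ (._ , t)) refl) = dT-AdjacentT (AdjacentT-sym (adjT-sound v u (proj₂ (to T-∧ t))))
  dT-step {u} {v} (fwd (inj₂ (._ , t)) refl) = dT-AdjacentJ (adjJ-sound u v (proj₂ (to T-∧ t)))
  dT-step {u} {v} (bwd (inj₂ (._ , t)) refl) = dT-AdjacentJ (AdjacentJ-sym (adjJ-sound v u (proj₂ (to T-∧ t))))

  dT-shift : ∀ s t P Q → dT (shift s P) (shift (s xor t) Q) ≡ dT P (shift t Q)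
  dT-shift false t     P Q = refl
  dT-shift true  false P Q = dT-antipodes P Q
  dT-shift true  true  (X , Y) (X′ , Y′) = cong₂ _+_ (dC-flipˡ X X′) (dC-flipˡ Y Y′)

  -- The walk lifts step by step to the torus, and its sign decides whether the lift ends at
  -- `lift v` or at the antipode.
  dT≤length : ∀ {u v} (W : Walk (TTJ g) u v) → dT (lift u) (shift (walkSign W) (lift v)) ≤ walkLength W
  dT≤length {u} [] = ≤-reflexive (dT-refl (lift u))
  dT≤length {u} {v} (_∷_ {w = w} s W) = ≤-trans
    (dT-triangle (lift u) (shift p (lift w)) (shift (p xor walkSign W) (lift v)))
    (+-mono-≤ (≤-reflexive (dT-step s)) (≤-trans (≤-reflexive (dT-shift p (walkSign W) (lift w) (lift v))) (dT≤length W)))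
    where p = sign (TTJ g) (stepEdge s)

  class : Torus a b → Bool
  class (X , Y) = classC X xor classC Y

  odd-dT : ∀ P Q → odd (dT P Q) ≡ class P xor class Q
  odd-dT (X , Y) (X′ , Y′) = trans (odd-+ (dC X X′) (dC Y Y′)) (trans (cong₂ _xor_ (odd-dC X X′) (odd-dC Y Y′))
    (xor-interchange (classC X) (classC X′) (classC Y) (classC Y′)))

  a+b≡g : a + b ≡ g
  a+b≡g = m+[n∸m]≡n (m/n≤m g 2)

  class-shift : ∀ s P → class (shift s P) ≡ class P xor (s ∧ odd g)
  class-shift false P = sym (xor-comm (class P) false)
  class-shift true ((i , s) , (j , t)) = trans
    (solve 6 (λ i s j t a b → (i :+ ((con true :+ s) :* a)) :+ (j :+ ((con true :+ t) :* b)) :=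
      ((i :+ (s :* a)) :+ (j :+ (t :* b))) :+ (a :+ b)) refl (odd (toℕ i)) s (odd (toℕ j)) t (odd a) (odd b))
    (cong (class ((i , s) , (j , t)) xor_) (trans (sym (odd-+ a b)) (cong odd a+b≡g)))
    where open xor-∧-Solver

  odd-length : ∀ {u v} (W : Walk (TTJ g) u v) →
    odd (walkLength W) ≡ class (lift u) xor (class (lift v) xor (walkSign W ∧ odd g))
  odd-length {u} [] = sym (trans (cong (class (lift u) xor_) (xor-identityʳ _)) (xor-same (class (lift u))))
  odd-length {u} {v} (_∷_ {w = w} s W) = trans
    (cong₂ _xor_ (trans (sym (cong odd (dT-step s))) (trans (odd-dT (lift u) (shift p (lift w))) (cong (class (lift u) xor_) (class-shift p (lift w))))) (odd-length W))
    (solve 6 (λ u v w p q g → (u :+ (w :+ (p :* g))) :+ (w :+ (v :+ (q :* g))) := u :+ (v :+ ((p :+ q) :* g))) refl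
      (class (lift u)) (class (lift v)) (class (lift w)) p (walkSign W) (odd g))
    where
    open xor-∧-Solver
    p = sign (TTJ g) (stepEdge s)

  -- A negative closed walk lifts to a walk between antipodes, which are a + b = g apart. The parity
  -- rule comes from the bipartition of the torus, where antipodes differ by the parity of g.
  TTJ-admissible : Admissible g (TTJ g)
  TTJ-admissible = record
    { closed-parity = λ {v} W → trans (odd-length W)
        (trans (sym (xor-assoc (class (lift v)) (class (lift v)) _)) (cong (_xor (walkSign W ∧ odd g)) (xor-same (class (lift v)))))
    ; closed-length = λ {v} W negative → ≤-trans (≤-reflexive (sym (far-antipode (lift v))))
        (subst (λ s → dT (lift v) (shift s (lift v)) ≤ walkLength W) negative (dT≤length W))
    }
    where
    far-antipode : ∀ P → dT P (antipode P) ≡ g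
    far-antipode P = trans (cong (_+ dT P (antipode P)) (sym (dT-refl P))) (trans (dT-antipode P P) a+b≡g)

  a≤b : a ≤ b
  a≤b = +-cancelˡ-≤ a a b (≤-trans (≤-reflexive (trans (sym (2*-+ a)) (*-comm 2 a))) (≤-trans (m/n*n≤m g 2) (≤-reflexive (sym a+b≡g))))

  b≤1+a : b ≤ suc a
  b≤1+a = +-cancelˡ-≤ a b (suc a) (begin
    a + b            ≡⟨ a+b≡g ⟩
    g                ≡⟨ m≡m%n+[m/n]*n g 2 ⟩
    g % 2 + a * 2    ≤⟨ +-monoˡ-≤ (a * 2) (≤-pred (m%n<n g 2)) ⟩
    1 + a * 2        ≡⟨ cong suc (trans (*-comm a 2) (2*-+ a)) ⟩
    suc (a + a)      ≡⟨ sym (+-suc a a) ⟩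
    a + suc a        ∎)
    where open ≤-Reasoning

  2ab≡g²/2 : 2 * a * b ≡ (g * g) / 2
  2ab≡g²/2 with m≤n⇒m<n∨m≡n a≤b
  ... | inj₂ a≡b = sym (trans (cong (_/ 2) (trans (cong₂ _*_ g≡ g≡) (lemma a))) (trans (m*n/n≡m (2 * a * a) 2) (cong (2 * a *_) a≡b)))
    where
    g≡ : g ≡ a + a
    g≡ = trans (sym a+b≡g) (cong (a +_) (sym a≡b))
    lemma : ∀ a → (a + a) * (a + a) ≡ (2 * a * a) * 2
    lemma = solve-∀
  -- For g = 2a + 1 the square is 1 + 4a(a + 1), and halving drops the 1.
  ... | inj₁ a<b = sym (trans (cong (_/ 2) (trans (cong₂ _*_ g≡ g≡) (lemma a)))
      (trans (+-distrib-/-∣ʳ 1 {2 * a * suc a * 2} {2} (divides (2 * a * suc a) refl)) (trans (m*n/n≡m (2 * a * suc a) 2) (cong (2 * a *_) b≡))))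
    where
    b≡ : suc a ≡ b
    b≡ = ≤-antisym a<b b≤1+a
    g≡ : g ≡ a + suc a
    g≡ = trans (sym a+b≡g) (cong (a +_) (sym b≡))
    lemma : ∀ a → (a + suc a) * (a + suc a) ≡ 1 + (2 * a * suc a) * 2
    lemma = solve-∀

  vertices : VT g ↔ Fin ((g * g) / 2)
  vertices = subst (λ k → VT g ↔ Fin k) 2ab≡g²/2 (↔-sym (*↔× {2 * a} {b}))

  target-place : ∀ {p q r} (P Q : Torus a b) → dT P Q ≡ p → Tripod p q r g → ∃ λ R → dT P R ≡ q × dT Q R ≡ r
  target-place P Q d (tripod {α} {β} {γ} {δ} refl refl refl total) =
    place-torus (≤-trans a≤b (n≤1+n b)) b≤1+a P Q {α} {β} {γ} {δ} d (trans total (sym a+b≡g))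

-- From the girth hypothesis to the homomorphism

girth-admissible : ∀ {g G} → (∀ ij → GirthGE G (TTJ g) ij) → Admissible g G
girth-admissible {g} {G} girth = record { closed-parity = parity′ ; closed-length = length′ }
  where
  open Admissible (Twisted.TTJ-admissible g)
  parity′ : ∀ {v} (W : Walk G v v) → odd (walkLength W) ≡ walkSign W ∧ odd g
  parity′ {v} W with girth (walkType W) v W refl
  ... | _ , W′ , type , _ = trans (sym (cong proj₂ type))
    (trans (closed-parity W′) (cong (_∧ odd g) (cong proj₁ type)))
  length′ : ∀ {v} (W : Walk G v v) → walkSign W ≡ true → g ≤ walkLength W
  length′ {v} W negative with girth (walkType W) v W refl
  ... | _ , W′ , type , W′≤W = ≤-trans (closed-length W′ (trans (cong proj₁ type) negative)) W′≤W

module Homomorphism {n m g} (2≤g : 2 ≤ g) (en : Fin m → Fin n × Fin n) (σ : Fin m → Bool) (root : Fin n)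
    (simple : Simple (finSG n m en σ)) (conn : Connected (finSG n m en σ)) (K4-free : K4MinorFree (finSG n m en σ))
    {c : Fin n → Bool} {D : SignedDistance (Fin n)} (metric : SignedMetric g c D) (tight : ∀ u v → Tight g u v D)
    (edge-length : ∀ e → D (proj₁ (en e)) (proj₂ (en e)) (σ e) ≡ 1) where
  open Twisted g
  open SignedMetric metric
  open TightMetric metric tight

  origin : Torus a b
  origin = (fromℕ< 0<a , false) , (fromℕ< (≤-trans 0<a a≤b) , false)
    where
    0<a : 0 < a
    0<a = m≥n⇒m/n>0 2≤g

  realisation : ∃ λ f → ∀ x y → Contraction.Adj en σ id x y → dT (f x) (f y) ≡ w x y
  realisation = Realisation.realise en σ conn K4-free root reflexive (λ u v → symmetric u v false) w-tripod
    {d = dT} origin dT-refl dT-sym target-place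

  f : Fin n → Torus a b
  f = proj₁ realisation

  -- A negative edge has w = g - 1. Its ends are placed g - 1 apart, so one of them is at distance 1
  -- from the antipode of the other.
  edge-distance : ∀ e → dT (f (proj₁ (en e))) (shift (σ e) (f (proj₂ (en e)))) ≡ 1
  edge-distance e = by-sign (σ e) (edge-length e)
    where
    x = proj₁ (en e)
    y = proj₂ (en e)
    apart : dT (f x) (f y) ≡ w x y
    apart = proj₂ realisation x y (Contraction.adjacent (proj₁ simple e) (e , inj₁ (refl , refl)))
    by-sign : ∀ s → D x y s ≡ 1 → dT (f x) (shift s (f y)) ≡ 1
    by-sign false short = trans apart short
    by-sign true  short = +-cancelˡ-≡ (w x y) _ _ (trans (cong (_+ dT (f x) (antipode (f y))) (sym apart))
      (trans (dT-antipode (f x) (f y)) (trans a+b≡g (trans (sym (w-antipodal x y)) (cong (w x y +_) short)))))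

  image : ∀ e → Edge (layer (f (proj₁ (en e))) xor (σ e xor layer (f (proj₂ (en e)))))
    (project (f (proj₁ (en e)))) (project (f (proj₂ (en e))))
  image e = subst₂ (λ s v → Edge (layer (f (proj₁ (en e))) xor s) (project (f (proj₁ (en e)))) v)
    (layer-shift (σ e) (f (proj₂ (en e)))) (project-shift (σ e) (f (proj₂ (en e))))
    (torus-edge (f (proj₁ (en e))) (shift (σ e) (f (proj₂ (en e)))) (edge-distance e))

  homomorphism : Hom (finSG n m en σ) (TTJ g)
  homomorphism = layer ∘ f , project ∘ f , proj₁ ∘ image , proj₁ ∘ proj₂ ∘ image ,
    λ e → trans (proj₂ (proj₂ (image e))) (xor-swap (layer (f (proj₁ (en e)))) (σ e) (layer (f (proj₂ (en e)))))
    where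
    open xor-∧-Solver
    xor-swap : ∀ p s q → p xor (s xor q) ≡ s xor (p xor q)
    xor-swap = solve 3 (λ p s q → p :+ (s :+ q) := s :+ (p :+ q)) refl

theorem6 : ∀ (g : ℕ) → 2 ≤ g →
    (V (TTJ g) ↔ Fin ((g * g) / 2)) × SPComplete (TTJ g)
theorem6 g 2≤g = Twisted.vertices g , complete
  where
  complete : SPComplete (TTJ g)
  -- The empty graph has no vertex to root the colouring at.
  complete zero m en σ _ _ _ _ = (λ ()) , (λ ()) , (λ e → none (en e)) , (λ e → none (en e)) , (λ e → none (en e))
    where
    none : {A : Set} → Fin 0 × Fin 0 → A
    none (() , _)
  complete (suc n) m en σ simple conn K4-free girth =
    let open Distances en σ 2≤g (girth-admissible girth) conn zero
        _ , metric , tight , short = tight-metric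
    in Homomorphism.homomorphism 2≤g en σ zero simple conn K4-free metric tight (λ e → short-edge metric e (short e))
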